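{- Let $M\in\mathbb{R}^{m\times m}$ and $q\in\mathbb{R}^m$ be such that $\mathrm{ELCP}(e,q,M)$ is nondegenerate. If $0\neq\bar u\in\mathrm{SOL}(e,M)$ is a nondegenerate solution of $\mathrm{LCP}(e,M)$, then one can compute, in strongly polynomial time, a vertex $(\bar z_0,\bar z)$ of $\mathrm{ELCP}(e,q,M)$ such that if $\bar z_0>0$ then $(\bar z_0,\bar z,1,\bar u)\in\mathrm{SR}_1(e,q,M)$ (that is, it is a type 1 secondary ray).
   Context: $e$ denotes the all-ones vector of appropriate dimension; vector inequalities are entrywise. $\mathrm{SOL}(q,M)$ is the set of all $z\in\mathbb{R}^m$ with $q+Mz\ge 0$, $z\ge 0$, $z^{T}(q+Mz)=0$ (the solutions of $\mathrm{LCP}(q,M)$). A solution $\bar u$ of $\mathrm{LCP}(e,M)$ is nondegenerate if, with $\bar v=M\bar u+e$, $\alpha=\{i:\bar u_i>0\}$ and $\bar\alpha=\{i:\bar v_i>0\}$, one has $\alpha\cup\bar\alpha=\{1,\dots,m\}$ and the principal submatrix $M_{\alpha\alpha}$ is nonsingular. $\mathrm{ELCP}(e,q,M)=\{(z_0,z)\in\mathbb{R}\times\mathbb{R}^m : z_0\ge 0,\ z\ge 0,\ q+ez_0+Mz\ge 0,\ z^{T}(q+ez_0+Mz)=0\}$. A vertex of $\mathrm{ELCP}(e,q,M)$ is an element of it that is a vertex of the associated polyhedron $\{(z_0,z): z_0\ge 0,\ z\ge 0,\ q+ez_0+Mz\ge 0\}$. $\mathrm{ELCP}(e,q,M)$ is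 nondegenerate if at each point of this polyhedron the active inequalities have linearly independent normals. $\mathrm{SR}_1(e,q,M)$ (type 1 secondary rays) is the set of all $(\bar z_0,\bar z,1,\bar u)$ such that $(\bar z_0,\bar z)$ is a vertex of $\mathrm{ELCP}(e,q,M)$, $\bar u\in\mathrm{SOL}(e,M)\setminus\{0\}$, $\bar z^{T}(e+M\bar u)=0$ and $\bar u^{T}(q+e\bar z_0+M\bar z)=0$. Strongly polynomial time means that the number of elementary operations (additions, subtractions, multiplications, divisions, comparisons) is bounded by a polynomial in $m$. -}

module Defs where

open import Algebra.Bundles using (CommutativeRing)
open import Algebra.Structures using (IsCommutativeRing)
open import Data.Fin.Base using (Fin; zero; suc; toℕ; fromℕ<)
open import Data.Fin.Properties using () renaming (_≟_ to _≟ᶠ_)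
open import Data.List.Base as List using (List; allFin; filter; foldr)
open import Data.Nat.Base as ℕ using (ℕ; zero; suc)
import Data.Nat.Properties as ℕₚ
open import Data.Product.Base using (∃-syntax; Σ-syntax; _×_; _,_; proj₁)
open import Data.Sum.Base using (_⊎_)
open import Data.Vec.Functional using (Vector; _∷_; _++_; replicate)
open import Level using (Level; _⊔_) renaming (suc to lsuc)
open import Relation.Binary.Core using (Rel)
open import Relation.Binary.Definitions using (Decidable)
open import Relation.Binary.Structures using (IsDecTotalOrder)
open import Relation.Nullary.Decidable.Core using (yes; no; ⌊_⌋)
open import Relation.Nullary.Negation.Core using (¬_)
open import Data.Bool.Base using (Bool; if_then_else_)

import Algebra.Properties.CommutativeMonoid.Sum as Sum
import Relation.Binary.Construct.NonStrictToStrict as ToStrict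

-- Stands in for ℝ, which is an instance.  The order is decidable because
-- comparisons are elementary operations of the machine below.
record OrderedField c ℓ₁ ℓ₂ : Set (lsuc (c ⊔ ℓ₁ ⊔ ℓ₂)) where
  infix  8 -_
  infixl 7 _*_
  infixl 6 _+_
  infix  4 _≈_ _≤_
  field
    Carrier           : Set c
    _≈_               : Rel Carrier ℓ₁
    _≤_               : Rel Carrier ℓ₂
    _+_ _*_           : Carrier → Carrier → Carrier
    -_                : Carrier → Carrier
    0# 1#             : Carrier
    isCommutativeRing : IsCommutativeRing _≈_ _+_ _*_ -_ 0# 1#
    0≉1               : ¬ (0# ≈ 1#)
    inverse           : ∀ x → ¬ (x ≈ 0#) → ∃[ y ] x * y ≈ 1#
    isDecTotalOrder   : IsDecTotalOrder _≈_ _≤_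
    +-monoˡ-≤         : ∀ {x y} z → x ≤ y → x + z ≤ y + z
    *-nonNeg          : ∀ {x y} → 0# ≤ x → 0# ≤ y → 0# ≤ x * y

  commutativeRing : CommutativeRing c ℓ₁
  commutativeRing = record { isCommutativeRing = isCommutativeRing }

  open IsDecTotalOrder isDecTotalOrder public using (_≟_; _≤?_)

  open CommutativeRing commutativeRing public using (_-_; +-commutativeMonoid)

  open Sum +-commutativeMonoid public using (sum)

  open ToStrict _≈_ _≤_ using (<-decidable)

  infix 4 _<_

  _<_ : Rel Carrier (ℓ₁ ⊔ ℓ₂)
  _<_ = ToStrict._<_ _≈_ _≤_

  _<?_ : Decidable _<_
  _<?_ = <-decidable _≟_ _≤?_

  infixl 7 _÷_

  -- Division by zero returns 0#.
  _÷_ : Carrier → Carrier → Carrier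
  x ÷ y with y ≟ 0#
  ... | yes _   = 0#
  ... | no  y≉0 = x * proj₁ (inverse y y≉0)

module LCP {c ℓ₁ ℓ₂} (R : OrderedField c ℓ₁ ℓ₂) where
  open OrderedField R

  private
    variable
      k m n : ℕ

  Vec : ℕ → Set c
  Vec = Vector Carrier

  Matrix : ℕ → ℕ → Set c
  Matrix m n = Vector (Vec n) m

  infixl 7 _·_ _⊛_ _⊗_
  infixl 6 _⊕_
  infix  4 _≋_

  0ᵛ e : Vec n
  0ᵛ = replicate _ 0#
  e  = replicate _ 1#

  _≋_ : Rel (Vec n) ℓ₁
  x ≋ y = ∀ i → x i ≈ y i

  Nonneg : Vec n → Set ℓ₂
  Nonneg x = ∀ i → 0# ≤ x i

  _⊕_ : Vec n → Vec n → Vec n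
  (x ⊕ y) i = x i + y i

  _·_ : Carrier → Vec n → Vec n
  (a · x) i = a * x i

  ⟨_,_⟩ : Vec n → Vec n → Carrier
  ⟨ x , y ⟩ = sum λ i → x i * y i

  _⊛_ : Matrix m n → Vec n → Vec m
  (M ⊛ x) i = ⟨ M i , x ⟩

  _⊗_ : Matrix k m → Matrix m n → Matrix k n
  (A ⊗ B) i j = sum λ l → A i l * B l j

  I : Matrix n n
  I i j = if ⌊ i ≟ᶠ j ⌋ then 1# else 0#

  Nonsingular : Matrix n n → Set (c ⊔ ℓ₁)
  Nonsingular {n} A =
    Σ[ B ∈ Matrix n n ] (∀ i → (A ⊗ B) i ≋ I i) × (∀ i → (B ⊗ A) i ≋ I i)

  principal : Matrix n n → (α : List (Fin n)) →
              Matrix (List.length α) (List.length α)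
  principal M α i j = M (List.lookup α i) (List.lookup α j)

  -- The family a restricted to the index set A is linearly independent.
  LinearlyIndependentOn : ∀ {ℓ} → (Fin k → Set ℓ) → Vector (Vec n) k →
                          Set (c ⊔ ℓ₁ ⊔ ℓ)
  LinearlyIndependentOn {k} A a =
    (coeff : Vec k) → (∀ i → ¬ A i → coeff i ≈ 0#) →
    (∀ j → (sum λ i → coeff i * a i j) ≈ 0#) → coeff ≋ 0ᵛ

  -- x is a vertex of the convex set P: it is not a proper convex combination
  -- of other points of P.
  IsVertexOf : ∀ {ℓ} → (Vec n → Set ℓ) → Vec n → Set (c ⊔ ℓ₁ ⊔ ℓ₂ ⊔ ℓ)
  IsVertexOf P x = P x × (∀ y y′ t → P y → P y′ → 0# < t → t < 1# →
    x ≋ t · y ⊕ (1# - t) · y′ → y ≋ x × y′ ≋ x)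

  SOL : Vec m → Matrix m m → Vec m → Set (ℓ₁ ⊔ ℓ₂)
  SOL q M z = Nonneg (q ⊕ M ⊛ z) × Nonneg z × ⟨ z , q ⊕ M ⊛ z ⟩ ≈ 0#

  support : Vec m → List (Fin m)
  support u = filter (λ i → 0# <? u i) (allFin _)

  NondegenerateSolution : Vec m → Matrix m m → Vec m → Set (c ⊔ ℓ₁ ⊔ ℓ₂)
  NondegenerateSolution q M u =
    SOL q M u ×
    (∀ i → 0# < u i ⊎ 0# < (M ⊛ u ⊕ q) i) ×
    Nonsingular (principal M (support u))

  -- A point (z₀ , z) of R × Rᵐ is the vector z₀ ∷ z of length 1 + m.

  slackʷ : Vec m → Vec m → Matrix m m → Vec (suc m) → Vec m
  slackʷ d q M x i = q i + d i * x zero + (M ⊛ (λ j → x (suc j))) i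

  Polyhedron : Vec m → Vec m → Matrix m m → Vec (suc m) → Set ℓ₂
  Polyhedron d q M x =
    0# ≤ x zero × Nonneg (λ i → x (suc i)) × Nonneg (slackʷ d q M x)

  ELCP : Vec m → Vec m → Matrix m m → Vec (suc m) → Set (ℓ₁ ⊔ ℓ₂)
  ELCP d q M x =
    Polyhedron d q M x × ⟨ (λ i → x (suc i)) , slackʷ d q M x ⟩ ≈ 0#

  VertexOfELCP : Vec m → Vec m → Matrix m m → Vec (suc m) → Set (c ⊔ ℓ₁ ⊔ ℓ₂)
  VertexOfELCP d q M x = ELCP d q M x × IsVertexOf (Polyhedron d q M) x

  -- The 1 + m + m defining inequalities of the polyhedron, in the order
  -- z₀ ≥ 0, z ≥ 0, q + d z₀ + M z ≥ 0: their values at a point and normals.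

  slacks : Vec m → Vec m → Matrix m m → Vec (suc m) → Vec (suc m ℕ.+ m)
  slacks d q M x = x ++ slackʷ d q M x

  normals : Vec m → Matrix m m → Matrix (suc m ℕ.+ m) (suc m)
  normals d M = I ++ (λ i → d i ∷ M i)

  NondegenerateELCP : Vec m → Vec m → Matrix m m → Set (c ⊔ ℓ₁ ⊔ ℓ₂)
  NondegenerateELCP d q M = ∀ x → Polyhedron d q M x →
    LinearlyIndependentOn (λ i → slacks d q M x i ≈ 0#) (normals d M)

  -- Type 1 secondary rays: (z̄₀ , z̄ , ū₀ , ū) with ū₀ = 1.
  SR₁ : Vec m → Vec m → Matrix m m →
        Carrier × Vec m × Carrier × Vec m → Set (c ⊔ ℓ₁ ⊔ ℓ₂)
  SR₁ d q M (z₀ , z , u₀ , u) =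
    u₀ ≈ 1# ×
    VertexOfELCP d q M (z₀ ∷ z) ×
    SOL d M u × ¬ (u ≋ 0ᵛ) ×
    ⟨ z , d ⊕ M ⊛ u ⟩ ≈ 0# ×
    ⟨ u , slackʷ d q M (z₀ ∷ z) ⟩ ≈ 0#

------------------------------------------------------------------------
-- Programs for a real random-access machine with finitely many
-- natural-number registers and finitely many two-dimensional arrays of field
-- elements.  One program serves all dimensions m.  Control flow is by
-- branching and by loops whose iteration count is read from a register on
-- entry, so every program terminates, but the number of steps is not
-- polynomially bounded in general.

Register Array : Set
Register = ℕ
Array    = ℕ

-- at a i j: the entry of array a at row and column given by the current
-- contents of the registers i and j.
data Location : Set where
  at : Array → Register → Register → Location

data Operation : Set where
  add sub mul div : Operation

data Expression : Set where
  zeroᴱ oneᴱ : Expression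
  copy       : Location → Expression
  apply      : Operation → Location → Location → Expression

data Test : Set where
  _≤ᶠ_      : Location → Location → Test
  _≤ʳ_ _≡ʳ_ : Register → Register → Test

infix  4 _≤ᶠ_ _≤ʳ_ _≡ʳ_
infixr 3 _⨾_
data Program : Set where
  skip        : Program
  _⨾_         : Program → Program → Program
  assign      : Location → Expression → Program
  zeroʳ sucʳ  : Register → Program
  copyʳ       : Register → Register → Program
  branch      : Test → Program → Program → Program
  -- for i n P: P with i set to 0, 1, …, (n on entry) - 1 in turn.
  for         : Register → Register → Program → Program

-- The polynomial with the given coefficients, constant term first.
evalPoly : List ℕ → ℕ → ℕ
evalPoly p x = foldr (λ a r → a ℕ.+ x ℕ.* r) 0 p

module Machine {c ℓ₁ ℓ₂} (R : OrderedField c ℓ₁ ℓ₂) where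
  open OrderedField R
  open LCP R

  record State : Set c where
    constructor state
    field
      reg : Register → ℕ
      mem : Array → ℕ → ℕ → Carrier
  open State public

  setReg : Register → ℕ → State → State
  setReg i v σ .reg j = if ⌊ i ℕₚ.≟ j ⌋ then v else reg σ j
  setReg i v σ .mem   = mem σ

  read : State → Location → Carrier
  read σ (at a i j) = mem σ a (reg σ i) (reg σ j)

  write : Location → Carrier → State → State
  write _             _ σ .reg       = reg σ
  write (at a i j) v σ .mem b k l =
    if ⌊ a ℕₚ.≟ b ⌋ then
      (if ⌊ reg σ i ℕₚ.≟ k ⌋ then
        (if ⌊ reg σ j ℕₚ.≟ l ⌋ then v else mem σ b k l)
       else mem σ b k l)
    else mem σ b k l

  operate : Operation → Carrier → Carrier → Carrier
  operate add = _+_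
  operate sub = _-_
  operate mul = _*_
  operate div = _÷_

  eval : State → Expression → Carrier
  eval σ zeroᴱ          = 0#
  eval σ oneᴱ           = 1#
  eval σ (copy x)       = read σ x
  eval σ (apply op x y) = operate op (read σ x) (read σ y)

  holds : State → Test → Bool
  holds σ (x ≤ᶠ y) = ⌊ read σ x ≤? read σ y ⌋
  holds σ (i ≤ʳ j) = ⌊ reg σ i ℕₚ.≤? reg σ j ⌋
  holds σ (i ≡ʳ j) = ⌊ reg σ i ℕₚ.≟ reg σ j ⌋

  -- iterate f n σ = f (n - 1) (… (f 1 (f 0 σ)))
  iterate : (ℕ → State → State) → ℕ → State → State
  iterate f zero    σ = σ
  iterate f (suc n) σ = f n (iterate f n σ)

  run : Program → State → State
  run skip           σ = σ
  run (P ⨾ Q)        σ = run Q (run P σ)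
  run (assign x t)   σ = write x (eval σ t) σ
  run (zeroʳ i)      σ = setReg i 0 σ
  run (sucʳ i)       σ = setReg i (suc (reg σ i)) σ
  run (copyʳ i j)    σ = setReg i (reg σ j) σ
  run (branch t P Q) σ = if holds σ t then run P σ else run Q σ
  run (for i n P)    σ = iterate (λ k τ → run P (setReg i k τ)) (reg σ n) σ

  -- Every elementary operation on field elements costs 1.  So do copying,
  -- register operations, register tests and every entry to and pass through
  -- a loop; hence the cost bounds the number of elementary operations.
  cost : Program → State → ℕ
  cost skip           σ = 0
  cost (P ⨾ Q)        σ = cost P σ ℕ.+ cost Q (run P σ)
  cost (assign x t)   σ = 1
  cost (zeroʳ i)      σ = 1
  cost (sucʳ i)       σ = 1
  cost (copyʳ i j)    σ = 1
  cost (branch t P Q) σ =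
    suc (if holds σ t then cost P σ else cost Q σ)
  cost (for i n P)    σ = passes (reg σ n)
    where
    passes : ℕ → ℕ
    passes zero    = 1
    passes (suc k) = passes k ℕ.+
      suc (cost P (setReg i k (iterate (λ l τ → run P (setReg i l τ)) k σ)))

  -- Entries outside the given dimensions are 0#.
  pad : ∀ {n} → Vec n → ℕ → Carrier
  pad {n} x k with k ℕₚ.<? n
  ... | yes k<n = x (fromℕ< k<n)
  ... | no  _   = 0#

  padMatrix : ∀ {m n} → Matrix m n → ℕ → ℕ → Carrier
  padMatrix {m} A k with k ℕₚ.<? m
  ... | yes k<m = pad (A (fromℕ< k<m))
  ... | no  _   = λ _ → 0#

  column : ∀ {n} → Vec n → ℕ → ℕ → Carrier
  column x k 0       = pad x k
  column x k (suc _) = 0#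

  -- Register 0 holds m; array 0 holds M; column 0 of the arrays 1 and 2 holds
  -- q and u.  All other registers and entries are zero.
  input : ∀ {m} → Matrix m m → Vec m → Vec m → State
  input {m} M q u .reg 0       = m
  input     M q u .reg (suc _) = 0
  input     M q u .mem 0       = padMatrix M
  input     M q u .mem 1       = column q
  input     M q u .mem 2       = column u
  input     M q u .mem (suc (suc (suc _))) = λ _ _ → 0#

  -- Results are returned in entry (0 , 0) of array 3 and in column 0 of array 4.
  output₀ : State → Carrier
  output₀ σ = mem σ 3 0 0

  output : ∀ {m} → State → Vec m
  output σ i = mem σ 4 (toℕ i) 0

module Submission where

-- Let α be the support of u.  Points (t , z) with z = 0 off α and
-- q + e t + M z = 0 on α form the line z = x + t u, where x solves
-- M_αα x_α = - q_α; along it the remaining constraints have positive slope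
-- because u is nondegenerate.  The endpoint of the feasible ray is the largest
-- of 0 and - (x + q + M x)ᵢ / (u + e + M u)ᵢ: of the summands zᵢ and wᵢ one
-- vanishes, so feasibility is nonnegativity of zᵢ + wᵢ.
--
-- The linear system is solved without pivoting: Gram–Schmidt is applied to the
-- rows of a bordered nonsingular matrix of order m + 1.  Its last row becomes
-- orthogonal to the others, hence solves the homogenised system.

open import Defs
open import Algebra.Bundles using (CommutativeRing)
open import Algebra.Solver.Ring.AlmostCommutativeRing using (fromCommutativeRing; _-Raw-AlmostCommutative⟶_)
open import Data.Bool.Base using (Bool; true; false; if_then_else_; T; _∨_)
open import Data.Fin.Base using (Fin; zero; suc; toℕ; fromℕ<)
open import Data.Integer.Base as ℤ using (ℤ; +_; -[1+_]; _⊖_)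
open import Data.List.Base as List using (List; []; allFin; filter; lookup)
open import Data.List.Membership.Propositional using (_∈_)
open import Data.List.Membership.Propositional.Properties using (∈-filter⁺; ∈-allFin; ∈-lookup)
open import Data.List.Relation.Unary.All as All using ()
open import Data.List.Relation.Unary.All.Properties using (all-filter)
open import Data.List.Relation.Unary.Any using (index)
open import Data.List.Relation.Unary.Any.Properties using (lookup-index)
open import Data.Maybe.Base using (Maybe; nothing; just)
open import Data.Nat.Base as ℕ using (ℕ; zero; suc; z<s; s<s) renaming (_≤_ to _≤ⁿ_)
open import Data.Nat.Solver using (module +-*-Solver)
open import Data.Product.Base using (Σ-syntax; ∃-syntax; _×_; _,_; proj₁; proj₂)
open import Data.Sum.Base using (_⊎_; inj₁; inj₂)
open import Data.Unit.Base using (⊤)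
open import Data.Vec.Functional using (_∷_)
open import Function.Base using (_∘_)
open import Level using (_⊔_)
open import Relation.Binary.PropositionalEquality.Core as ≡ using (_≡_; _≢_)
open import Relation.Binary.Structures using (IsDecTotalOrder)
open import Relation.Nullary.Decidable using (Dec; yes; no; ⌊_⌋; isYes≗does; False; toWitnessFalse; fromWitnessFalse)
open import Relation.Nullary.Negation.Core using (¬_; contradiction)
open import Relation.Unary using (Pred; Decidable)
import Algebra.Properties.AbelianGroup as AbelianGroupProperties
import Algebra.Properties.Ring as RingProperties
import Algebra.Properties.Semiring.Mult.TCOptimised as SemiringMult
import Algebra.Properties.Semiring.Sum as SemiringSum
import Algebra.Solver.Ring as RingSolver
import Data.Fin.Properties as Fin
import Data.Integer.Properties as ℤₚ
import Data.Nat.Properties as ℕₚ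
import Relation.Binary.Reasoning.Setoid as SetoidReasoning

-- Pivoting would oblige the program to search for nonzero entries and to permute rows. Gram-Schmidt
-- divides only by squared norms of rows. Over an ordered field such a norm vanishes only for a zero
-- row, and row operations never produce one from an invertible matrix. The border and the unit rows
-- avoid extracting M_αα. A unit row off α forces its coordinate to vanish, so the whole matrix of
-- order m + 1 inherits invertibility from M_αα, and all loops run over plain index ranges. Its last
-- row starts as a unit vector and ends as a nonzero vector in the kernel of the original first m
-- rows; its last coordinate cannot vanish, again because M_αα is nonsingular, and dividing by it
-- yields x.

-- Ring solver with integer coefficients

module IntegerCoefficients {c ℓ} (R : CommutativeRing c ℓ) where
  open CommutativeRing R
  open RingProperties ring
  open AbelianGroupProperties +-abelianGroup using (⁻¹-∙-comm)
  open SemiringMult semiring using (×-homo-+; ×1-homo-*; 1+×) renaming (_×_ to infixl 8 _×ᵤ_)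
  open SetoidReasoning setoid

  -- With the optimised multiple, `1 ×ᵤ 1#` reduces to `1#`, so `con (+ 1)` in a solver equation
  -- matches `1#` by computation.
  ⟦_⟧ᶻ : ℤ → Carrier
  ⟦ + n ⟧ᶻ      = n ×ᵤ 1#
  ⟦ -[1+ n ] ⟧ᶻ = - (suc n ×ᵤ 1#)

  ⊖-homo : ∀ m n → ⟦ m ⊖ n ⟧ᶻ ≈ m ×ᵤ 1# - n ×ᵤ 1#
  ⊖-homo m zero = sym (trans (+-congˡ -0#≈0#) (+-identityʳ _))
  ⊖-homo zero (suc n) = sym (+-identityˡ _)
  ⊖-homo (suc m) (suc n) = begin
    ⟦ suc m ⊖ suc n ⟧ᶻ                  ≡⟨ ≡.cong ⟦_⟧ᶻ (ℤₚ.[1+m]⊖[1+n]≡m⊖n m n) ⟩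
    ⟦ m ⊖ n ⟧ᶻ                          ≈⟨ ⊖-homo m n ⟩
    a - b                               ≈⟨ +-congʳ (+-identityˡ a) ⟨
    (0# + a) - b                        ≈⟨ +-congʳ (+-congʳ (-‿inverseʳ 1#)) ⟨
    (1# - 1# + a) - b                   ≈⟨ +-congʳ (+-assoc _ _ _) ⟩
    (1# + (- 1# + a)) - b               ≈⟨ +-congʳ (+-congˡ (+-comm _ _)) ⟩
    (1# + (a - 1#)) - b                 ≈⟨ +-congʳ (+-assoc _ _ _) ⟨
    (1# + a - 1#) - b                   ≈⟨ +-assoc _ _ _ ⟩
    (1# + a) + (- 1# - b)               ≈⟨ +-congˡ (⁻¹-∙-comm 1# b) ⟩
    (1# + a) - (1# + b)                 ≈⟨ +-cong (1+× m 1#) (-‿cong (1+× n 1#)) ⟨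
    suc m ×ᵤ 1# - suc n ×ᵤ 1#             ∎
    where a = m ×ᵤ 1# ; b = n ×ᵤ 1#

  neg-homo : ∀ i → ⟦ ℤ.- i ⟧ᶻ ≈ - ⟦ i ⟧ᶻ
  neg-homo (+ zero)   = sym -0#≈0#
  neg-homo (+ suc n)  = refl
  neg-homo -[1+ n ]   = sym (-‿involutive _)

  +-homoᶻ : ∀ i j → ⟦ i ℤ.+ j ⟧ᶻ ≈ ⟦ i ⟧ᶻ + ⟦ j ⟧ᶻ
  +-homoᶻ (+ m)    (+ n)    = ×-homo-+ 1# m n
  +-homoᶻ (+ m)    -[1+ n ] = ⊖-homo m (suc n)
  +-homoᶻ -[1+ m ] (+ n)    = trans (⊖-homo n (suc m)) (+-comm _ _)
  +-homoᶻ -[1+ m ] -[1+ n ] = begin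
    - (suc (suc (m ℕ.+ n)) ×ᵤ 1#)    ≡⟨ ≡.cong (λ k → - (suc k ×ᵤ 1#)) (ℕₚ.+-suc m n) ⟨
    - ((suc m ℕ.+ suc n) ×ᵤ 1#)      ≈⟨ -‿cong (×-homo-+ 1# (suc m) (suc n)) ⟩
    - (suc m ×ᵤ 1# + suc n ×ᵤ 1#)     ≈⟨ ⁻¹-∙-comm _ _ ⟨
    - (suc m ×ᵤ 1#) - suc n ×ᵤ 1#     ∎

  pos-*-homoᶻ : ∀ m j → ⟦ + m ℤ.* j ⟧ᶻ ≈ m ×ᵤ 1# * ⟦ j ⟧ᶻ
  pos-*-homoᶻ m (+ n) = begin
    ⟦ + m ℤ.* + n ⟧ᶻ    ≡⟨ ≡.cong ⟦_⟧ᶻ (ℤₚ.pos-* m n) ⟨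
    (m ℕ.* n) ×ᵤ 1#      ≈⟨ ×1-homo-* m n ⟩
    m ×ᵤ 1# * (n ×ᵤ 1#)   ∎
  pos-*-homoᶻ m -[1+ n ] = begin
    ⟦ + m ℤ.* -[1+ n ] ⟧ᶻ           ≡⟨ ≡.cong ⟦_⟧ᶻ (ℤₚ.neg-distribʳ-* (+ m) (+ suc n)) ⟨
    ⟦ ℤ.- (+ m ℤ.* + suc n) ⟧ᶻ      ≈⟨ neg-homo (+ m ℤ.* + suc n) ⟩
    - ⟦ + m ℤ.* + suc n ⟧ᶻ          ≈⟨ -‿cong (pos-*-homoᶻ m (+ suc n)) ⟩
    - (m ×ᵤ 1# * (suc n ×ᵤ 1#))       ≈⟨ -‿distribʳ-* _ _ ⟩
    m ×ᵤ 1# * - (suc n ×ᵤ 1#)         ∎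

  *-homoᶻ : ∀ i j → ⟦ i ℤ.* j ⟧ᶻ ≈ ⟦ i ⟧ᶻ * ⟦ j ⟧ᶻ
  *-homoᶻ (+ m)    j = pos-*-homoᶻ m j
  *-homoᶻ -[1+ m ] j = begin
    ⟦ -[1+ m ] ℤ.* j ⟧ᶻ             ≡⟨ ≡.cong ⟦_⟧ᶻ (ℤₚ.neg-distribˡ-* (+ suc m) j) ⟨
    ⟦ ℤ.- (+ suc m ℤ.* j) ⟧ᶻ        ≈⟨ neg-homo (+ suc m ℤ.* j) ⟩
    - ⟦ + suc m ℤ.* j ⟧ᶻ            ≈⟨ -‿cong (pos-*-homoᶻ (suc m) j) ⟩
    - (suc m ×ᵤ 1# * ⟦ j ⟧ᶻ)         ≈⟨ -‿distribˡ-* _ _ ⟩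
    - (suc m ×ᵤ 1#) * ⟦ j ⟧ᶻ         ∎

  homomorphism : ℤ.+-*-rawRing -Raw-AlmostCommutative⟶ fromCommutativeRing R
  homomorphism = record
    { ⟦_⟧    = ⟦_⟧ᶻ
    ; +-homo = +-homoᶻ
    ; *-homo = *-homoᶻ
    ; -‿homo = neg-homo
    ; 0-homo = refl
    ; 1-homo = refl
    }

  dec : ∀ i j → Maybe (⟦ i ⟧ᶻ ≈ ⟦ j ⟧ᶻ)
  dec i j with i ℤₚ.≟ j
  ... | yes ≡.refl = just refl
  ... | no  _      = nothing

  open RingSolver ℤ.+-*-rawRing (fromCommutativeRing R) homomorphism
    dec public

-- Arithmetic of cost polynomials

infixl 6 _⊞_

_⊞_ : List ℕ → List ℕ → List ℕ
[]      ⊞ q       = q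
(a List.∷ p) ⊞ []      = a List.∷ p
(a List.∷ p) ⊞ (b List.∷ q) = (a ℕ.+ b) List.∷ (p ⊞ q)

evalPoly-⊞ : ∀ p q x → evalPoly (p ⊞ q) x ≡ evalPoly p x ℕ.+ evalPoly q x
evalPoly-⊞ []      q       x = ≡.refl
evalPoly-⊞ (a List.∷ p) []      x = ≡.sym (ℕₚ.+-identityʳ _)
evalPoly-⊞ (a List.∷ p) (b List.∷ q) x = ≡.trans
  (≡.cong (λ r → a ℕ.+ b ℕ.+ x ℕ.* r) (evalPoly-⊞ p q x))
  (solve 5 (λ a b x p q → a :+ b :+ x :* (p :+ q) := (a :+ x :* p) :+ (b :+ x :* q)) ≡.refl
    a b x (evalPoly p x) (evalPoly q x))
  where open +-*-Solver

-- Substitution of `x + 1` in Horner form: `a + (x + 1) r` is `a + (r + x r)`, where `r` is the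
-- tail, already shifted.
shift : List ℕ → List ℕ
shift []      = []
shift (a List.∷ p) = (a List.∷ []) ⊞ (shift p ⊞ (0 List.∷ shift p))

evalPoly-shift : ∀ p x → evalPoly (shift p) x ≡ evalPoly p (suc x)
evalPoly-shift []      x = ≡.refl
evalPoly-shift (a List.∷ p) x
  rewrite evalPoly-⊞ (a List.∷ []) (shift p ⊞ (0 List.∷ shift p)) x
        | evalPoly-⊞ (shift p) (0 List.∷ shift p) x
        | evalPoly-shift p x
        | ℕₚ.*-zeroʳ x
        | ℕₚ.+-identityʳ a
        = ≡.refl

-- Syntactic conditions on programs

-- Defined by recursion on the syntax, so that for a concrete program the condition evaluates to a
-- product of unit types and can be left implicit.
KeepsRegister : Register → Program → Set
KeepsRegister r skip           = ⊤
KeepsRegister r (P ⨾ Q)        = KeepsRegister r P × KeepsRegister r Q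
KeepsRegister r (assign _ _)   = ⊤
KeepsRegister r (zeroʳ i)      = False (i ℕₚ.≟ r)
KeepsRegister r (sucʳ i)       = False (i ℕₚ.≟ r)
KeepsRegister r (copyʳ i _)    = False (i ℕₚ.≟ r)
KeepsRegister r (branch _ P Q) = KeepsRegister r P × KeepsRegister r Q
KeepsRegister r (for i _ P)    = False (i ℕₚ.≟ r) × KeepsRegister r P

KeepsArray : Array → Program → Set
KeepsArray a skip                  = ⊤
KeepsArray a (P ⨾ Q)               = KeepsArray a P × KeepsArray a Q
KeepsArray a (assign (at b _ _) _) = False (b ℕₚ.≟ a)
KeepsArray a (zeroʳ _)             = ⊤
KeepsArray a (sucʳ _)              = ⊤
KeepsArray a (copyʳ _ _)           = ⊤
KeepsArray a (branch _ P Q)        = KeepsArray a P × KeepsArray a Q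
KeepsArray a (for _ _ P)           = KeepsArray a P

-- Two bounding registers are allowed because some loops run over the order `m + 1` of the bordered
-- matrix and others over `m`. Loop bodies must preserve both, so that nested loops stay bounded as
-- well.
LoopsOver : Register → Register → Program → Set
LoopsOver r s (P ⨾ Q)        = LoopsOver r s P × LoopsOver r s Q
LoopsOver r s (branch _ P Q) = LoopsOver r s P × LoopsOver r s Q
LoopsOver r s (for i n P)    =
  T (⌊ n ℕₚ.≟ r ⌋ ∨ ⌊ n ℕₚ.≟ s ⌋) × False (i ℕₚ.≟ r) × False (i ℕₚ.≟ s) ×
  KeepsRegister r P × KeepsRegister s P × LoopsOver r s P
LoopsOver _ _ _              = ⊤

-- Coefficients of a polynomial in a common bound `N` on the loop counts. A loop contributes
-- `1 + N (1 + b)`, where `b` bounds the body; consing is multiplication by `N`.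
costBound : Program → List ℕ
costBound skip           = []
costBound (P ⨾ Q)        = costBound P ⊞ costBound Q
costBound (branch _ P Q) = List.[ 1 ] ⊞ (costBound P ⊞ costBound Q)
costBound (for _ _ P)    = 1 List.∷ (List.[ 1 ] ⊞ costBound P)
costBound _              = List.[ 1 ]

-- Stated for any function with the right recursion equations, so that it applies to the auxiliary
-- function local to `cost`.
loop-cost-bounded : ∀ {b} (passes body : ℕ → ℕ) → passes 0 ≡ 1 →
  (∀ k → passes (suc k) ≡ passes k ℕ.+ suc (body k)) →
  (∀ k → body k ≤ⁿ b) → ∀ n → passes n ≤ⁿ 1 ℕ.+ n ℕ.* suc b
loop-cost-bounded passes body zero≡ suc≡ body≤b zero = ℕₚ.≤-reflexive zero≡
loop-cost-bounded {b} passes body zero≡ suc≡ body≤b (suc n) = begin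
  passes (suc n)                 ≡⟨ suc≡ n ⟩
  passes n ℕ.+ suc (body n)      ≤⟨ ℕₚ.+-mono-≤ (loop-cost-bounded passes body zero≡ suc≡ body≤b n) (ℕ.s≤s (body≤b n)) ⟩
  1 ℕ.+ n ℕ.* suc b ℕ.+ suc b    ≡⟨ ≡.cong suc (ℕₚ.+-comm (n ℕ.* suc b) (suc b)) ⟩
  1 ℕ.+ suc n ℕ.* suc b          ∎
  where open ℕₚ.≤-Reasoning

-- The program

-- After the setup register 0 holds m + 1 and register 5 holds m; register 4 and
-- entry (0 , 0) of array 9 stay zero.  Array 5 is the bordered matrix, arrays 6,
-- 7 and 8 hold scalars, and 3 and 4 are the output arrays.
scalar : Array → Location
scalar a = at a 4 4

innerProduct : Array → Location → Location → Register → Program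
innerProduct s x y n =
  assign (scalar s) zeroᴱ ⨾
  for 3 n (assign (scalar 7) (apply mul x y) ⨾
           assign (scalar s) (apply add (scalar s) (scalar 7)))

setup buildEntry buildRow build : Program
updateEntry updateRow reduceRow considerRow reduceRows eliminate : Program
normaliseEntry normalise quotient ratio choose updateStep stepLength advanceEntry advance main program : Program

setup = copyʳ 5 0 ⨾ sucʳ 0

buildEntry =
  -- For row `m` the padding of `u` supplies zero, so the test sends this row to the unit-vector
  -- case without a branch of its own.
  branch (at 2 1 4 ≤ᶠ scalar 9)
    (branch (1 ≡ʳ 2) (assign (at 5 1 2) oneᴱ) (assign (at 5 1 2) zeroᴱ))
    (branch (2 ≡ʳ 5) (assign (at 5 1 2) (copy (at 1 1 4))) (assign (at 5 1 2) (copy (at 0 1 2))))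

buildRow = for 2 0 buildEntry

build = for 1 0 buildRow

updateEntry =
  assign (scalar 7) (apply mul (scalar 6) (at 5 1 3)) ⨾
  assign (at 5 2 3) (apply sub (at 5 2 3) (scalar 7))

reduceRow =
  innerProduct 8 (at 5 1 3) (at 5 1 3) 0 ⨾
  innerProduct 6 (at 5 2 3) (at 5 1 3) 0 ⨾
  assign (scalar 6) (apply div (scalar 6) (scalar 8)) ⨾
  updateRow

updateRow = for 3 0 updateEntry

-- Loops always start at zero; this test passes over the rows up to and including the pivot row.
considerRow = branch (2 ≤ʳ 1) skip reduceRow

reduceRows = for 2 0 considerRow

eliminate = for 1 5 reduceRows

-- Register 5 holds `m`: numerators come from the last row, and the denominator is its homogenising
-- coordinate.
normaliseEntry = assign (at 4 1 4) (apply div (at 5 5 1) (at 5 5 5))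

normalise = for 1 5 normaliseEntry

-- For row i, scalar 6 becomes - (xᵢ + (qᵢ + (M x)ᵢ)) / (uᵢ + (1 + (M u)ᵢ)).
ratio =
  innerProduct 8 (at 0 1 3) (at 2 3 4) 5 ⨾
  innerProduct 6 (at 0 1 3) (at 4 3 4) 5 ⨾
  quotient

quotient =
  assign (scalar 7) oneᴱ ⨾
  assign (scalar 8) (apply add (scalar 7) (scalar 8)) ⨾
  assign (scalar 8) (apply add (at 2 1 4) (scalar 8)) ⨾
  assign (scalar 6) (apply add (at 1 1 4) (scalar 6)) ⨾
  assign (scalar 6) (apply add (at 4 1 4) (scalar 6)) ⨾
  assign (scalar 6) (apply div (scalar 6) (scalar 8)) ⨾
  assign (scalar 6) (apply sub (scalar 9) (scalar 6))

-- Array 3 is blank on input, so the running maximum is over zero and the ratios.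
choose = branch (scalar 6 ≤ᶠ scalar 3) skip (assign (scalar 3) (copy (scalar 6)))

updateStep = ratio ⨾ choose

stepLength = for 1 5 updateStep

advanceEntry =
  assign (scalar 7) (apply mul (scalar 3) (at 2 1 4)) ⨾
  assign (at 4 1 4) (apply add (at 4 1 4) (scalar 7))

advance = for 1 5 advanceEntry

main = build ⨾ eliminate ⨾ normalise ⨾ stepLength ⨾ advance

-- `setup` alters register 0 and therefore stays outside `main`, whose loop bounds have to remain
-- constant.
program = setup ⨾ main

-- The cost of `main` is bounded by a polynomial in `m + 1`, the order of the bordered matrix;
-- `shift` re-expands it in `m`.
polynomial : List ℕ
polynomial = shift (List.[ 2 ] ⊞ costBound main)

module Development {c ℓ₁ ℓ₂} (R : OrderedField c ℓ₁ ℓ₂) where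
  open OrderedField R
  open LCP R
  open Machine R
  open CommutativeRing commutativeRing
    using ( refl; sym; trans; reflexive; setoid; semiring
          ; +-cong; +-congˡ; +-congʳ; *-cong; *-congˡ; *-congʳ; -‿cong
          ; +-identityˡ; +-identityʳ; *-identityˡ; *-identityʳ
          ; +-comm; *-comm; -‿inverseʳ )
    renaming (zeroˡ to *-zeroˡ; zeroʳ to *-zeroʳ)
  open RingProperties (CommutativeRing.ring commutativeRing) using (-0#≈0#)
  open IsDecTotalOrder isDecTotalOrder
    using (total; antisym; ≤-respˡ-≈; ≤-respʳ-≈)
    renaming (refl to ≤-refl; trans to ≤-trans; reflexive to ≤-reflexive)
  open IntegerCoefficients commutativeRing
    using (solve; _:=_; _:+_; _:*_; _:-_; :-_; con)
  open SemiringSum semiring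
    using (sum-cong-≋; sum-replicate-zero; ∑-distrib-+; ∑-comm; *-distribˡ-sum; *-distribʳ-sum)
  open SetoidReasoning setoid

  -- Ordered field arithmetic

  x≤y⇒0≤y-x : ∀ {x y} → x ≤ y → 0# ≤ y - x
  x≤y⇒0≤y-x {x} x≤y = ≤-respˡ-≈ (-‿inverseʳ x) (+-monoˡ-≤ (- x) x≤y)

  0≤y-x⇒x≤y : ∀ {x y} → 0# ≤ y - x → x ≤ y
  0≤y-x⇒x≤y {x} {y} 0≤y-x =
    ≤-respʳ-≈ (solve 2 (λ y x → y :- x :+ x := y) refl y x)
      (≤-respˡ-≈ (+-identityˡ x) (+-monoˡ-≤ x 0≤y-x))

  +-nonNeg : ∀ {x y} → 0# ≤ x → 0# ≤ y → 0# ≤ x + y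
  +-nonNeg {x} {y} 0≤x 0≤y =
    ≤-trans 0≤y (≤-respˡ-≈ (+-identityˡ y) (+-monoˡ-≤ y 0≤x))

  +-nonNeg-≈0 : ∀ {x y} → 0# ≤ x → 0# ≤ y → x + y ≈ 0# → x ≈ 0#
  +-nonNeg-≈0 {x} {y} 0≤x 0≤y x+y≈0 = antisym x≤0 0≤x
    where
    x≤0 : x ≤ 0#
    x≤0 = 0≤y-x⇒x≤y (≤-respʳ-≈ (begin
      y                ≈⟨ solve 2 (λ x y → y := x :+ y :- x) refl x y ⟩
      x + y - x        ≈⟨ +-congʳ x+y≈0 ⟩
      0# - x           ∎) 0≤y)

  square-nonNeg : ∀ x → 0# ≤ x * x
  square-nonNeg x with total 0# x
  ... | inj₁ 0≤x = *-nonNeg 0≤x 0≤x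
  ... | inj₂ x≤0 = ≤-respʳ-≈ (solve 1 (λ x → (con (+ 0) :- x) :* (con (+ 0) :- x) := x :* x) refl x)
    (*-nonNeg (x≤y⇒0≤y-x x≤0) (x≤y⇒0≤y-x x≤0))

  *-≈0 : ∀ {x y} → x * y ≈ 0# → ¬ y ≈ 0# → x ≈ 0#
  *-≈0 {x} {y} xy≈0 y≉0 with inverse y y≉0
  ... | y⁻¹ , yy⁻¹≈1 = begin
    x              ≈⟨ *-identityʳ x ⟨
    x * 1#         ≈⟨ *-congˡ yy⁻¹≈1 ⟨
    x * (y * y⁻¹)  ≈⟨ solve 3 (λ x y z → x :* (y :* z) := (x :* y) :* z) refl x y y⁻¹ ⟩
    (x * y) * y⁻¹  ≈⟨ *-congʳ xy≈0 ⟩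
    0# * y⁻¹       ≈⟨ *-zeroˡ y⁻¹ ⟩
    0#             ∎

  square≈0 : ∀ {x} → x * x ≈ 0# → x ≈ 0#
  square≈0 {x} xx≈0 with x ≟ 0#
  ... | yes x≈0 = x≈0
  ... | no  x≉0 = *-≈0 xx≈0 x≉0

  ÷-* : ∀ x {y} → ¬ y ≈ 0# → (x ÷ y) * y ≈ x
  ÷-* x {y} y≉0 with y ≟ 0#
  ... | yes y≈0 = contradiction y≈0 y≉0
  ... | no  y≉0 with inverse y y≉0
  ...   | y⁻¹ , yy⁻¹≈1 = begin
    x * y⁻¹ * y    ≈⟨ solve 3 (λ x y z → x :* z :* y := x :* (y :* z)) refl x y y⁻¹ ⟩
    x * (y * y⁻¹)  ≈⟨ *-congˡ yy⁻¹≈1 ⟩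
    x * 1#         ≈⟨ *-identityʳ x ⟩
    x              ∎

  0<x⇒0≤x : ∀ {x} → 0# < x → 0# ≤ x
  0<x⇒0≤x = proj₁

  0<x⇒x≉0 : ∀ {x} → 0# < x → ¬ x ≈ 0#
  0<x⇒x≉0 (_ , 0≉x) x≈0 = 0≉x (sym x≈0)

  nonNeg∧≯0⇒≈0 : ∀ {x} → 0# ≤ x → ¬ 0# < x → x ≈ 0#
  nonNeg∧≯0⇒≈0 {x} 0≤x x≯0 with x ≟ 0#
  ... | yes x≈0 = x≈0
  ... | no  x≉0 = contradiction (0≤x , λ 0≈x → x≉0 (sym 0≈x)) x≯0

  -- Sums, inner products and matrices

  sum-nonNeg : ∀ {n} {f : Vec n} → Nonneg f → 0# ≤ sum f
  sum-nonNeg {zero}  0≤f = ≤-refl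
  sum-nonNeg {suc n} 0≤f = +-nonNeg (0≤f zero) (sum-nonNeg (0≤f ∘ suc))

  sum-nonNeg-≈0 : ∀ {n} {f : Vec n} → Nonneg f → sum f ≈ 0# → f ≋ 0ᵛ
  sum-nonNeg-≈0 0≤f Σf≈0 zero = +-nonNeg-≈0 (0≤f zero) (sum-nonNeg (0≤f ∘ suc)) Σf≈0
  sum-nonNeg-≈0 0≤f Σf≈0 (suc i) =
    sum-nonNeg-≈0 (0≤f ∘ suc)
      (+-nonNeg-≈0 (sum-nonNeg (0≤f ∘ suc)) (0≤f zero) (trans (+-comm _ _) Σf≈0)) i

  sum-≈0 : ∀ {n} {f : Vec n} → f ≋ 0ᵛ → sum f ≈ 0#
  sum-≈0 {n} f≋0 = trans (sum-cong-≋ f≋0) (sum-replicate-zero n)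

  ⟨⟩-cong : ∀ {n} {x x′ y y′ : Vec n} → x ≋ x′ → y ≋ y′ → ⟨ x , y ⟩ ≈ ⟨ x′ , y′ ⟩
  ⟨⟩-cong x≋x′ y≋y′ = sum-cong-≋ λ i → *-cong (x≋x′ i) (y≋y′ i)

  ⟨⟩-comm : ∀ {n} (x y : Vec n) → ⟨ x , y ⟩ ≈ ⟨ y , x ⟩
  ⟨⟩-comm x y = sum-cong-≋ λ i → *-comm (x i) (y i)

  ⟨⟩-linearʳ : ∀ {n} (a x y : Vec n) t → ⟨ a , x ⊕ t · y ⟩ ≈ ⟨ a , x ⟩ + t * ⟨ a , y ⟩
  ⟨⟩-linearʳ a x y t = begin
    sum (λ i → a i * (x i + t * y i))
      ≈⟨ sum-cong-≋ (λ i → solve 4 (λ a x y t → a :* (x :+ t :* y) := a :* x :+ t :* (a :* y)) refl (a i) (x i) (y i) t) ⟩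
    sum (λ i → a i * x i + t * (a i * y i))
      ≈⟨ ∑-distrib-+ (λ i → a i * x i) _ ⟩
    ⟨ a , x ⟩ + sum (λ i → t * (a i * y i))
      ≈⟨ +-congˡ (*-distribˡ-sum t (λ i → a i * y i)) ⟨
    ⟨ a , x ⟩ + t * ⟨ a , y ⟩ ∎

  ⟨⟩-linearˡ : ∀ {n} (x y b : Vec n) t → ⟨ x ⊕ t · y , b ⟩ ≈ ⟨ x , b ⟩ + t * ⟨ y , b ⟩
  ⟨⟩-linearˡ x y b t = begin
    ⟨ x ⊕ t · y , b ⟩          ≈⟨ ⟨⟩-comm (x ⊕ t · y) b ⟩
    ⟨ b , x ⊕ t · y ⟩          ≈⟨ ⟨⟩-linearʳ b x y t ⟩
    ⟨ b , x ⟩ + t * ⟨ b , y ⟩  ≈⟨ +-cong (⟨⟩-comm b x) (*-congˡ (⟨⟩-comm b y)) ⟩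
    ⟨ x , b ⟩ + t * ⟨ y , b ⟩  ∎

  ⟨⟩-zeroʳ : ∀ {n} (a : Vec n) {x} → x ≋ 0ᵛ → ⟨ a , x ⟩ ≈ 0#
  ⟨⟩-zeroʳ a x≋0 = sum-≈0 λ i → trans (*-congˡ (x≋0 i)) (*-zeroʳ (a i))

  -- Here the order enters Gram-Schmidt: a sum of squares vanishes only termwise, so the norm of a
  -- nonzero row is a legitimate divisor.
  ⟨⟩-definite : ∀ {n} {x : Vec n} → ⟨ x , x ⟩ ≈ 0# → x ≋ 0ᵛ
  ⟨⟩-definite {x = x} xx≈0 i = square≈0 (sum-nonNeg-≈0 (λ i → square-nonNeg (x i)) xx≈0 i)

  ⊗-⊛-assoc : ∀ {k m n} (A : Matrix k m) (B : Matrix m n) x → (A ⊗ B) ⊛ x ≋ A ⊛ (B ⊛ x)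
  ⊗-⊛-assoc A B x i = begin
    sum (λ j → sum (λ l → A i l * B l j) * x j)    ≈⟨ sum-cong-≋ (λ j → *-distribʳ-sum (x j) (λ l → A i l * B l j)) ⟩
    sum (λ j → sum (λ l → A i l * B l j * x j))    ≈⟨ ∑-comm (λ j l → A i l * B l j * x j) ⟩
    sum (λ l → sum (λ j → A i l * B l j * x j))
      ≈⟨ sum-cong-≋ (λ l → sum-cong-≋ (λ j → solve 3 (λ a b c → a :* b :* c := a :* (b :* c)) refl (A i l) (B l j) (x j))) ⟩
    sum (λ l → sum (λ j → A i l * (B l j * x j)))  ≈⟨ sum-cong-≋ (λ l → *-distribˡ-sum (A i l) (λ j → B l j * x j)) ⟨
    sum (λ l → A i l * sum (λ j → B l j * x j))    ∎

  I-suc : ∀ {n} (i j : Fin n) → I (suc i) (suc j) ≡ I i j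
  I-suc i j with i Fin.≟ j
  ... | yes _ = ≡.refl
  ... | no  _ = ≡.refl

  I-⊛ : ∀ {n} (x : Vec n) → I ⊛ x ≋ x
  I-⊛ x zero    = trans (+-cong (*-identityˡ (x zero)) (sum-≈0 λ i → *-zeroˡ (x (suc i)))) (+-identityʳ _)
  I-⊛ x (suc i) = trans
    (+-cong (*-zeroˡ (x zero))
      (trans (sum-cong-≋ (λ j → *-congʳ (reflexive (I-suc i j)))) (I-⊛ (x ∘ suc) i)))
    (+-identityˡ _)

  -- Sums unfold at the front, whereas the program accumulates at the back and the border of the
  -- matrix is its last column.
  sum-snoc : ∀ n (f : ℕ → Carrier) → sum {suc n} (f ∘ toℕ) ≈ sum {n} (f ∘ toℕ) + f n
  sum-snoc zero    f = +-comm (f 0) 0#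
  sum-snoc (suc n) f = begin
    f 0 + sum {suc n} (f ∘ suc ∘ toℕ)                    ≈⟨ +-congˡ (sum-snoc n (f ∘ suc)) ⟩
    f 0 + (sum {n} (f ∘ suc ∘ toℕ) + f (suc n))          ≈⟨ solve 3 (λ x y z → x :+ (y :+ z) := x :+ y :+ z) refl (f 0) _ (f (suc n)) ⟩
    f 0 + sum {n} (f ∘ suc ∘ toℕ) + f (suc n)            ∎

  sum-filter : ∀ {a p} {A : Set a} {P : Pred A p} (P? : Decidable P) (f : A → Carrier) →
    (∀ x → ¬ P x → f x ≈ 0#) → ∀ xs →
    sum (f ∘ lookup (filter P? xs)) ≈ sum (f ∘ lookup xs)
  sum-filter P? f f≈0 []       = refl
  sum-filter P? f f≈0 (x List.∷ xs) with P? x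
  ... | yes _  = +-congˡ (sum-filter P? f f≈0 xs)
  ... | no ¬px = trans (sum-filter P? f f≈0 xs) (sym (trans (+-congʳ (f≈0 x ¬px)) (+-identityˡ _)))

  sum-tabulate : ∀ {a n} {A : Set a} (g : Fin n → A) (f : A → Carrier) →
    sum (f ∘ lookup (List.tabulate g)) ≡ sum (f ∘ g)
  sum-tabulate {n = zero}  g f = ≡.refl
  sum-tabulate {n = suc n} g f = ≡.cong (λ s → f (g zero) + s) (sum-tabulate (g ∘ suc) f)

  -- Linear systems with a nonsingular principal submatrix

  module _ {p m} {P : Pred (Fin m) p} (P? : Decidable P) (M : Matrix m m)
    (nonsingular : Nonsingular (principal M (filter P? (allFin m)))) where

    private
      α : List (Fin m)
      α = filter P? (allFin m)

      Mα B : Matrix (List.length α) (List.length α)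
      Mα = principal M α
      B  = proj₁ nonsingular

      α⊆P : ∀ l → P (lookup α l)
      α⊆P l = All.lookup (all-filter P? (allFin m)) (∈-lookup l)

      P⊆α : ∀ {i} → P i → i ∈ α
      P⊆α {i} = ∈-filter⁺ P? (∈-allFin i)

    -- The right inverse `B` solves the system on α, and `D` scatters the solution over all
    -- coordinates: column `l` of `D` is the unit vector at the `l`-th element of α, so `M ⊗ D`
    -- selects the columns of `M` indexed by α.
    principal-solve : ∀ r → ∃[ x ] (∀ i → ¬ P i → x i ≈ 0#) × (∀ i → P i → (M ⊛ x) i ≈ r i)
    principal-solve r = x , x-off , x-on
      where
      y : Vec (List.length α)
      y = B ⊛ (r ∘ lookup α)

      D : Matrix m (List.length α)
      D j l = I (lookup α l) j

      x : Vec m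
      x = D ⊛ y

      x-off : ∀ i → ¬ P i → x i ≈ 0#
      x-off i ¬Pi = sum-≈0 λ l → trans (*-congʳ (reflexive (D≡0 l))) (*-zeroˡ (y l))
        where
        D≡0 : ∀ l → D i l ≡ 0#
        D≡0 l with lookup α l Fin.≟ i
        ... | yes ≡.refl = contradiction (α⊆P l) ¬Pi
        ... | no  _      = ≡.refl

      MD : ∀ i l → (M ⊗ D) i l ≈ M i (lookup α l)
      MD i l = trans (⟨⟩-comm (M i) (I (lookup α l))) (I-⊛ (M i) (lookup α l))

      Mx-lookup : ∀ l → (M ⊛ x) (lookup α l) ≈ r (lookup α l)
      Mx-lookup l = begin
        (M ⊛ (D ⊛ y)) i                    ≈⟨ ⊗-⊛-assoc M D y i ⟨
        ((M ⊗ D) ⊛ y) i                    ≈⟨ ⟨⟩-cong (MD i) (λ _ → refl) ⟩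
        (Mα ⊛ (B ⊛ (r ∘ lookup α))) l      ≈⟨ ⊗-⊛-assoc Mα B (r ∘ lookup α) l ⟨
        ((Mα ⊗ B) ⊛ (r ∘ lookup α)) l      ≈⟨ ⟨⟩-cong (proj₁ (proj₂ nonsingular) l) (λ _ → refl) ⟩
        (I ⊛ (r ∘ lookup α)) l             ≈⟨ I-⊛ (r ∘ lookup α) l ⟩
        r i                                ∎
        where i = lookup α l

      x-on : ∀ i → P i → (M ⊛ x) i ≈ r i
      x-on i Pi = ≡.subst (λ j → (M ⊛ x) j ≈ r j) (≡.sym (lookup-index (P⊆α Pi))) (Mx-lookup (index (P⊆α Pi)))

    -- A vector vanishing off α meets only the columns of `M` in α, so its restriction lies in the
    -- kernel of `Mα`, and the left inverse kills it.
    principal-injective : ∀ x → (∀ i → ¬ P i → x i ≈ 0#) →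
      (∀ i → P i → (M ⊛ x) i ≈ 0#) → x ≋ 0ᵛ
    principal-injective x x-off Mx-on i with P? i
    ... | no ¬Pi = x-off i ¬Pi
    ... | yes Pi = ≡.subst (λ j → x j ≈ 0#) (≡.sym (lookup-index (P⊆α Pi))) (y≈0 (index (P⊆α Pi)))
      where
      y : Vec (List.length α)
      y = x ∘ lookup α

      My≈0 : Mα ⊛ y ≋ 0ᵛ
      My≈0 l = begin
        sum (λ k → M j (lookup α k) * x (lookup α k))
          ≈⟨ sum-filter P? (λ k → M j k * x k) (λ k ¬Pk → trans (*-congˡ (x-off k ¬Pk)) (*-zeroʳ _)) (allFin m) ⟩
        sum (λ k → M j (lookup (allFin m) k) * x (lookup (allFin m) k))
          ≡⟨ sum-tabulate (λ k → k) (λ k → M j k * x k) ⟩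
        (M ⊛ x) j
          ≈⟨ Mx-on j (α⊆P l) ⟩
        0# ∎
        where j = lookup α l

      y≈0 : y ≋ 0ᵛ
      y≈0 l = begin
        y l               ≈⟨ I-⊛ y l ⟨
        (I ⊛ y) l         ≈⟨ ⟨⟩-cong (proj₂ (proj₂ nonsingular) l) (λ _ → refl) ⟨
        ((B ⊗ Mα) ⊛ y) l  ≈⟨ ⊗-⊛-assoc B Mα y l ⟩
        (B ⊛ (Mα ⊛ y)) l  ≈⟨ ⟨⟩-zeroʳ (B l) My≈0 ⟩
        0#                ∎

  -- The endpoint of the feasible ray is a vertex

  module RayEndpoint {m} (M : Matrix m m) (q u : Vec m) (solution : SOL e M u)
    (nondegenerate : NondegenerateSolution e M u) where

    v : Vec m
    v = e ⊕ M ⊛ u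

    0≤v : Nonneg v
    0≤v = proj₁ solution

    0≤u : Nonneg u
    0≤u = proj₁ (proj₂ solution)

    uv≈0 : ∀ i → u i * v i ≈ 0#
    uv≈0 = sum-nonNeg-≈0 (λ i → *-nonNeg (0≤u i) (0≤v i)) (proj₂ (proj₂ solution))

    u-off : ∀ i → ¬ 0# < u i → u i ≈ 0#
    u-off i = nonNeg∧≯0⇒≈0 (0≤u i)

    v-on : ∀ i → 0# < u i → v i ≈ 0#
    v-on i 0<uᵢ = *-≈0 (trans (*-comm (v i) (u i)) (uv≈0 i)) (0<x⇒x≉0 0<uᵢ)

    offset : Vec m → Vec m
    offset x i = x i + (q i + (M ⊛ x) i)

    slope : Vec m
    slope i = u i + v i

    0≤slope : ∀ i → 0# ≤ slope i
    0≤slope i = +-nonNeg (0≤u i) (0≤v i)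

    -- By strict complementarity one of the two nonnegative summands is positive. This keeps the
    -- ratios defined and lets a blocking row determine the parameter.
    slope≉0 : ∀ i → ¬ slope i ≈ 0#
    slope≉0 i uᵢ+vᵢ≈0 with proj₁ (proj₂ nondegenerate) i
    ... | inj₁ 0<uᵢ = 0<x⇒x≉0 0<uᵢ (+-nonNeg-≈0 (0≤u i) (0≤v i) uᵢ+vᵢ≈0)
    ... | inj₂ 0<vᵢ = 0<x⇒x≉0 0<vᵢ (trans (+-comm _ _)
      (+-nonNeg-≈0 (0≤v i) (0≤u i) (trans (+-comm _ _) uᵢ+vᵢ≈0)))

    w : Vec (suc m) → Vec m
    w = slackʷ e q M

    -- The slack is affine, and the weights sum to one, so its constant term is reproduced.
    w-convex : ∀ x y y′ t → x ≋ t · y ⊕ (1# - t) · y′ →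
      ∀ i → w x i ≈ t * w y i + (1# - t) * w y′ i
    w-convex x y y′ t x≋ i = begin
      q i + 1# * x zero + ⟨ M i , x ∘ suc ⟩
        ≈⟨ +-cong (+-congˡ (*-congˡ (x≋ zero))) (⟨⟩-cong (λ _ → refl) (x≋ ∘ suc)) ⟩
      q i + 1# * (t * y zero + (1# - t) * y′ zero) + ⟨ M i , t · (y ∘ suc) ⊕ (1# - t) · (y′ ∘ suc) ⟩
        ≈⟨ +-congˡ (⟨⟩-linearʳ (M i) (t · (y ∘ suc)) (y′ ∘ suc) (1# - t)) ⟩
      q i + 1# * (t * y zero + (1# - t) * y′ zero) + (⟨ M i , t · (y ∘ suc) ⟩ + (1# - t) * ⟨ M i , y′ ∘ suc ⟩)
        ≈⟨ +-congˡ (+-congʳ ⟨⟩-scale) ⟩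
      q i + 1# * (t * y zero + (1# - t) * y′ zero) + (t * ⟨ M i , y ∘ suc ⟩ + (1# - t) * ⟨ M i , y′ ∘ suc ⟩)
        ≈⟨ solve 6 (λ q y y′ t a b →
             q :+ con (+ 1) :* (t :* y :+ (con (+ 1) :- t) :* y′) :+ (t :* a :+ (con (+ 1) :- t) :* b)
             := t :* (q :+ con (+ 1) :* y :+ a) :+ (con (+ 1) :- t) :* (q :+ con (+ 1) :* y′ :+ b))
             refl (q i) (y zero) (y′ zero) t ⟨ M i , y ∘ suc ⟩ ⟨ M i , y′ ∘ suc ⟩ ⟩
      t * w y i + (1# - t) * w y′ i ∎
      where
      ⟨⟩-scale : ⟨ M i , t · (y ∘ suc) ⟩ ≈ t * ⟨ M i , y ∘ suc ⟩
      ⟨⟩-scale = trans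
        (sum-cong-≋ λ j → solve 3 (λ a t y → a :* (t :* y) := t :* (a :* y)) refl (M i j) t (y (suc j)))
        (sym (*-distribˡ-sum t (λ j → M i j * y (suc j))))

    -- The face argument: nonnegative terms with sum zero both vanish and the weights are nonzero,
    -- so a constraint active at a proper convex combination of feasible points is active at both.
    convex-≈0 : ∀ {t x y} → 0# < t → t < 1# → 0# ≤ x → 0# ≤ y →
      t * x + (1# - t) * y ≈ 0# → x ≈ 0# × y ≈ 0#
    convex-≈0 {t} {x} {y} 0<t (t≤1 , t≉1) 0≤x 0≤y combination≈0 =
      *-≈0 (trans (*-comm _ _) (+-nonNeg-≈0 0≤tx 0≤1-ty combination≈0)) (0<x⇒x≉0 0<t) ,
      *-≈0 (trans (*-comm _ _) (+-nonNeg-≈0 0≤1-ty 0≤tx (trans (+-comm _ _) combination≈0))) 1-t≉0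
      where
      0≤1-t : 0# ≤ 1# - t
      0≤1-t = x≤y⇒0≤y-x t≤1

      1-t≉0 : ¬ 1# - t ≈ 0#
      1-t≉0 1-t≈0 = t≉1 (begin
        t              ≈⟨ +-identityˡ t ⟨
        0# + t         ≈⟨ +-congʳ 1-t≈0 ⟨
        1# - t + t     ≈⟨ solve 2 (λ o t → o :- t :+ t := o) refl 1# t ⟩
        1#             ∎)

      0≤tx : 0# ≤ t * x
      0≤tx = *-nonNeg (0<x⇒0≤x 0<t) 0≤x

      0≤1-ty : 0# ≤ (1# - t) * y
      0≤1-ty = *-nonNeg 0≤1-t 0≤y

    -- The constraints active along the ray cut out its line; the constraint
    -- that blocks the ray at z₀ then determines the endpoint.
    module _ (x : Vec m)
      (x-off : ∀ i → ¬ 0# < u i → x i ≈ 0#)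
      (x-on : ∀ i → 0# < u i → q i + (M ⊛ x) i ≈ 0#)
      (z₀ : Carrier) (0≤z₀ : 0# ≤ z₀)
      (feasible : ∀ i → 0# ≤ offset x i + z₀ * slope i)
      (blocking : z₀ ≈ 0# ⊎ (∃[ i ] offset x i + z₀ * slope i ≈ 0#))
      (z : Vec m) (z≋ : z ≋ x ⊕ z₀ · u) where

      private
        P : Vec (suc m)
        P = z₀ ∷ z

      w-ray : ∀ y → (∀ i → y (suc i) ≈ x i + y zero * u i) →
        ∀ i → w y i ≈ (q i + (M ⊛ x) i) + y zero * v i
      w-ray y y≋ i = begin
        q i + 1# * y zero + ⟨ M i , y ∘ suc ⟩
          ≈⟨ +-congˡ (trans (⟨⟩-cong (λ _ → refl) y≋) (⟨⟩-linearʳ (M i) x u (y zero))) ⟩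
        q i + 1# * y zero + (⟨ M i , x ⟩ + y zero * ⟨ M i , u ⟩)
          ≈⟨ solve 4 (λ q y a b → q :+ con (+ 1) :* y :+ (a :+ y :* b) := q :+ a :+ y :* (con (+ 1) :+ b))
               refl (q i) (y zero) ⟨ M i , x ⟩ ⟨ M i , u ⟩ ⟩
        q i + ⟨ M i , x ⟩ + y zero * v i ∎

      z+w-ray : ∀ y → (∀ i → y (suc i) ≈ x i + y zero * u i) →
        ∀ i → y (suc i) + w y i ≈ offset x i + y zero * slope i
      z+w-ray y y≋ i = trans (+-cong (y≋ i) (w-ray y y≋ i))
        (solve 5 (λ x y u s v → (x :+ y :* u) :+ (s :+ y :* v) := x :+ s :+ y :* (u :+ v))
          refl (x i) (y zero) (u i) (q i + (M ⊛ x) i) (v i))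

      z-off : ∀ i → ¬ 0# < u i → z i ≈ 0#
      z-off i uᵢ≯0 = begin
        z i             ≈⟨ z≋ i ⟩
        x i + z₀ * u i  ≈⟨ +-cong (x-off i uᵢ≯0) (*-congˡ (u-off i uᵢ≯0)) ⟩
        0# + z₀ * 0#    ≈⟨ trans (+-identityˡ _) (*-zeroʳ z₀) ⟩
        0#              ∎

      w-on : ∀ i → 0# < u i → w P i ≈ 0#
      w-on i 0<uᵢ = begin
        w P i                           ≈⟨ w-ray P z≋ i ⟩
        q i + (M ⊛ x) i + z₀ * v i      ≈⟨ +-cong (x-on i 0<uᵢ) (*-congˡ (v-on i 0<uᵢ)) ⟩
        0# + z₀ * 0#                    ≈⟨ trans (+-identityˡ _) (*-zeroʳ z₀) ⟩
        0#                              ∎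

      0≤z+w : ∀ i → 0# ≤ z i + w P i
      0≤z+w i = ≤-respʳ-≈ (sym (z+w-ray P z≋ i)) (feasible i)

      0≤z×0≤w : ∀ i → 0# ≤ z i × 0# ≤ w P i
      0≤z×0≤w i with 0# <? u i
      ... | yes 0<uᵢ =
        ≤-respʳ-≈ (trans (+-congˡ (w-on i 0<uᵢ)) (+-identityʳ _)) (0≤z+w i) ,
        ≤-reflexive (sym (w-on i 0<uᵢ))
      ... | no uᵢ≯0 =
        ≤-reflexive (sym (z-off i uᵢ≯0)) ,
        ≤-respʳ-≈ (trans (+-congʳ (z-off i uᵢ≯0)) (+-identityˡ _)) (0≤z+w i)

      feasible-P : Polyhedron e q M P
      feasible-P = 0≤z₀ , proj₁ ∘ 0≤z×0≤w , proj₂ ∘ 0≤z×0≤w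

      private
        -- The common source of all complementarity conditions: `z` and `u` vanish off the support
        -- of `u`, while `w` and `v` vanish on it.
        product-≈0 : ∀ {a b : Vec m} → (∀ i → ¬ 0# < u i → a i ≈ 0#) →
          (∀ i → 0# < u i → b i ≈ 0#) → ⟨ a , b ⟩ ≈ 0#
        product-≈0 {a} {b} a-off b-on = sum-≈0 product
          where
          product : ∀ i → a i * b i ≈ 0#
          product i with 0# <? u i
          ... | yes 0<uᵢ = trans (*-congˡ (b-on i 0<uᵢ)) (*-zeroʳ (a i))
          ... | no uᵢ≯0  = trans (*-congʳ (a-off i uᵢ≯0)) (*-zeroˡ (b i))

      elcp : ELCP e q M P
      elcp = feasible-P , product-≈0 z-off w-on

      active⇒≋ : ∀ y → (z₀ ≈ 0# → y zero ≈ 0#) → (∀ i → z i ≈ 0# → y (suc i) ≈ 0#) →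
        (∀ i → w P i ≈ 0# → w y i ≈ 0#) → y ≋ P
      active⇒≋ y y₀-active z-active w-active = y≋P
        where
        y₀ : Carrier
        y₀ = y zero

        line δ : Vec m
        line = x ⊕ y₀ · u
        -- The deviation of `y` from the point of the line with the same parameter. The constraints
        -- active along the whole line make it a kernel vector of M_αα supported on α.
        δ = (y ∘ suc) ⊕ (- 1#) · line

        δ-off : ∀ i → ¬ 0# < u i → δ i ≈ 0#
        δ-off i uᵢ≯0 = begin
          y (suc i) + - 1# * (x i + y₀ * u i)
            ≈⟨ +-cong (z-active i (z-off i uᵢ≯0)) (*-congˡ (+-cong (x-off i uᵢ≯0) (*-congˡ (u-off i uᵢ≯0)))) ⟩
          0# + - 1# * (0# + y₀ * 0#)
            ≈⟨ solve 1 (λ y → con (+ 0) :+ (:- con (+ 1)) :* (con (+ 0) :+ y :* con (+ 0)) := con (+ 0)) refl y₀ ⟩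
          0# ∎

        δ-on : ∀ i → 0# < u i → (M ⊛ δ) i ≈ 0#
        δ-on i 0<uᵢ = begin
          ⟨ M i , δ ⟩
            ≈⟨ ⟨⟩-linearʳ (M i) (y ∘ suc) line (- 1#) ⟩
          ⟨ M i , y ∘ suc ⟩ + - 1# * ⟨ M i , line ⟩
            ≈⟨ solve 4 (λ q y a b → a :+ (:- con (+ 1)) :* b := (q :+ con (+ 1) :* y :+ a) :- (q :+ con (+ 1) :* y :+ b))
                 refl (q i) y₀ ⟨ M i , y ∘ suc ⟩ ⟨ M i , line ⟩ ⟩
          w y i - w (y₀ ∷ line) i
            ≈⟨ +-cong (w-active i (w-on i 0<uᵢ)) (-‿cong (trans (w-ray (y₀ ∷ line) (λ _ → refl) i)
                 (+-cong (x-on i 0<uᵢ) (*-congˡ (v-on i 0<uᵢ))))) ⟩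
          0# - (0# + y₀ * 0#)
            ≈⟨ solve 1 (λ y → con (+ 0) :- (con (+ 0) :+ y :* con (+ 0)) := con (+ 0)) refl y₀ ⟩
          0# ∎

        on-line : ∀ i → y (suc i) ≈ x i + y₀ * u i
        on-line i = begin
          y (suc i)         ≈⟨ solve 2 (λ a b → a := a :+ (:- con (+ 1)) :* b :+ b) refl (y (suc i)) (line i) ⟩
          δ i + line i      ≈⟨ +-congʳ (principal-injective (λ i → 0# <? u i) M (proj₂ (proj₂ nondegenerate)) δ δ-off δ-on i) ⟩
          0# + line i       ≈⟨ +-identityˡ _ ⟩
          line i            ∎

        blocking⇒y₀≈z₀ : z₀ ≈ 0# ⊎ (∃[ i ] offset x i + z₀ * slope i ≈ 0#) → y₀ ≈ z₀
        blocking⇒y₀≈z₀ (inj₁ z₀≈0) = trans (y₀-active z₀≈0) (sym z₀≈0)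
        blocking⇒y₀≈z₀ (inj₂ (i , blocked)) = begin
          y₀             ≈⟨ solve 2 (λ y z → y := y :- z :+ z) refl y₀ z₀ ⟩
          y₀ - z₀ + z₀   ≈⟨ +-congʳ (*-≈0 difference (slope≉0 i)) ⟩
          0# + z₀        ≈⟨ +-identityˡ z₀ ⟩
          z₀             ∎
          where
          zᵢ+wᵢ≈0 : z i + w P i ≈ 0#
          zᵢ+wᵢ≈0 = trans (z+w-ray P z≋ i) blocked

          zᵢ≈0 : z i ≈ 0#
          zᵢ≈0 = +-nonNeg-≈0 (proj₁ (0≤z×0≤w i)) (proj₂ (0≤z×0≤w i)) zᵢ+wᵢ≈0

          wᵢ≈0 : w P i ≈ 0#
          wᵢ≈0 = +-nonNeg-≈0 (proj₂ (0≤z×0≤w i)) (proj₁ (0≤z×0≤w i)) (trans (+-comm _ _) zᵢ+wᵢ≈0)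

          difference : (y₀ - z₀) * slope i ≈ 0#
          -- At the blocking row both `z` and `w` vanish at the endpoint, hence also at `y`. The
          -- affine function with this offset and slope thus has the zeros `y₀` and `z₀`, which a
          -- nonzero slope forces to agree.
          difference = begin
            (y₀ - z₀) * slope i
              ≈⟨ solve 4 (λ y z d f → (y :- z) :* d := (f :+ y :* d) :- (f :+ z :* d)) refl y₀ z₀ (slope i) (offset x i) ⟩
            (offset x i + y₀ * slope i) - (offset x i + z₀ * slope i)
              ≈⟨ +-cong (sym (z+w-ray y on-line i)) (-‿cong blocked) ⟩
            (y (suc i) + w y i) - 0#
              ≈⟨ +-cong (+-cong (z-active i zᵢ≈0) (w-active i wᵢ≈0)) -0#≈0# ⟩
            0# + 0# + 0#
              ≈⟨ trans (+-identityʳ _) (+-identityʳ _) ⟩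
            0# ∎

        y₀≈z₀ : y₀ ≈ z₀
        y₀≈z₀ = blocking⇒y₀≈z₀ blocking

        y≋P : y ≋ P
        y≋P zero    = y₀≈z₀
        y≋P (suc i) = trans (on-line i) (trans (+-congˡ (*-congʳ y₀≈z₀)) (sym (z≋ i)))

      vertex : VertexOfELCP e q M P
      vertex = elcp , feasible-P , extreme
        where
        extreme : ∀ y y′ t → Polyhedron e q M y → Polyhedron e q M y′ → 0# < t → t < 1# →
          P ≋ t · y ⊕ (1# - t) · y′ → y ≋ P × y′ ≋ P
        extreme y y′ t (0≤y₀ , 0≤y , 0≤wy) (0≤y′₀ , 0≤y′ , 0≤wy′) 0<t t<1 P≋ =
          active⇒≋ y (proj₁ ∘ both₀) (λ i → proj₁ ∘ both i) (λ i → proj₁ ∘ bothʷ i) ,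
          active⇒≋ y′ (proj₂ ∘ both₀) (λ i → proj₂ ∘ both i) (λ i → proj₂ ∘ bothʷ i)
          where
          both₀ : z₀ ≈ 0# → y zero ≈ 0# × y′ zero ≈ 0#
          both₀ z₀≈0 = convex-≈0 0<t t<1 0≤y₀ 0≤y′₀ (trans (sym (P≋ zero)) z₀≈0)

          both : ∀ i → z i ≈ 0# → y (suc i) ≈ 0# × y′ (suc i) ≈ 0#
          both i zᵢ≈0 = convex-≈0 0<t t<1 (0≤y i) (0≤y′ i) (trans (sym (P≋ (suc i))) zᵢ≈0)

          bothʷ : ∀ i → w P i ≈ 0# → w y i ≈ 0# × w y′ i ≈ 0#
          bothʷ i wᵢ≈0 = convex-≈0 0<t t<1 (0≤wy i) (0≤wy′ i)
            (trans (sym (w-convex P y y′ t P≋ i)) wᵢ≈0)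

      secondary-ray : ¬ u ≋ 0ᵛ → SR₁ e q M (z₀ , z , 1# , u)
      secondary-ray u≉0 =
        refl , vertex , solution , u≉0 , product-≈0 z-off v-on , product-≈0 u-off w-on

  -- Gram-Schmidt without pivoting

  -- Vectors are functions on all of `ℕ`, cut off at length `n`, so that an array of the machine is
  -- itself a matrix.
  dot : ℕ → (ℕ → Carrier) → (ℕ → Carrier) → Carrier
  dot n x y = ⟨ x ∘ toℕ {n} , y ∘ toℕ ⟩

  Rows : Set c
  Rows = ℕ → ℕ → Carrier

  dot-congˡ : ∀ n {x x′} y → (∀ l → l ℕ.< n → x l ≈ x′ l) → dot n x y ≈ dot n x′ y
  dot-congˡ n y x≈x′ = ⟨⟩-cong (λ i → x≈x′ (toℕ i) (Fin.toℕ<n i)) (λ _ → refl)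

  -- In row k of the elimination, the rows k + 1, …, j - 1 have already been
  -- made orthogonal to row k; B is the original matrix.
  record Partial (m : ℕ) (B A : Rows) (k j : ℕ) : Set (c ⊔ ℓ₁) where
    field
      annihilates : ∀ x → (∀ i → i ℕ.< m → dot (suc m) (A i) x ≈ 0#) →
        ∀ i → i ℕ.< m → dot (suc m) (B i) x ≈ 0#
      onto : ∀ (b : ℕ → Carrier) → ∃[ x ] (∀ i → i ℕ.< suc m → dot (suc m) (A i) x ≈ b i)
      orthogonal : ∀ i l → i ℕ.< suc m → l ℕ.< k → l ℕ.< i → dot (suc m) (A i) (A l) ≈ 0#
      orthogonal-row : ∀ i → i ℕ.< suc m → i ℕ.< j → k ℕ.< i → dot (suc m) (A i) (A k) ≈ 0#

  open Partial

  module _ {m : ℕ} {B : Rows} where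

    private
      N : ℕ
      N = suc m

    no-rows : ∀ {A} → (∀ i → i ℕ.< N → ∀ l → l ℕ.< N → A i l ≈ B i l) →
      (∀ (b : ℕ → Carrier) → ∃[ x ] (∀ i → i ℕ.< N → dot N (B i) x ≈ b i)) → Partial m B A 0 0
    no-rows {A} A≈B B-onto = record
      { annihilates    = λ x Ax≈0 i i<m →
          trans (sym (dot-A x i (ℕₚ.<-trans i<m (ℕₚ.n<1+n m)))) (Ax≈0 i i<m)
      ; onto           = λ b → proj₁ (B-onto b) , λ i i<N →
          trans (dot-A (proj₁ (B-onto b)) i i<N) (proj₂ (B-onto b) i i<N)
      ; orthogonal     = λ _ _ _ ()
      ; orthogonal-row = λ _ _ ()
      }
      where
      dot-A : ∀ x i → i ℕ.< N → dot N (A i) x ≈ dot N (B i) x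
      dot-A x i i<N = dot-congˡ N x (A≈B i i<N)

    next-row : ∀ {A k} → Partial m B A k N → Partial m B A (suc k) 0
    next-row {A} {k} p = record
      { annihilates    = annihilates p
      ; onto           = onto p
      ; orthogonal     = orthogonal′
      ; orthogonal-row = λ _ _ ()
      }
      where
      orthogonal′ : ∀ i l → i ℕ.< N → l ℕ.< suc k → l ℕ.< i → dot N (A i) (A l) ≈ 0#
      orthogonal′ i l i<N l<1+k l<i with ℕₚ.m≤n⇒m<n∨m≡n (ℕ.s≤s⁻¹ l<1+k)
      ... | inj₁ l<k    = orthogonal p i l i<N l<k l<i
      ... | inj₂ ≡.refl = orthogonal-row p i i<N i<N l<i

    skip-row : ∀ {A k j} → j ℕ.≤ k → Partial m B A k j → Partial m B A k (suc j)
    skip-row j≤k p = record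
      { annihilates    = annihilates p
      ; onto           = onto p
      ; orthogonal     = orthogonal p
      ; orthogonal-row = λ i i<N i<1+j k<i →
          contradiction (ℕₚ.≤-trans (ℕ.s≤s⁻¹ i<1+j) j≤k) (ℕₚ.<⇒≱ k<i)
      }

    -- `onto` is the form of invertibility that row operations carry along, and it excludes zero
    -- rows: with right-hand side all ones, a zero row would give 0 = 1.
    norm≉0 : ∀ {A k j} → Partial m B A k j → ∀ i → i ℕ.< N → ¬ dot N (A i) (A i) ≈ 0#
    norm≉0 {A} p i i<N AA≈0 with onto p (λ _ → 1#)
    ... | x , Ax≈1 = 0≉1 (begin
      0#             ≈⟨ ⟨⟩-zeroʳ (x ∘ toℕ {N}) (⟨⟩-definite {x = A i ∘ toℕ} AA≈0) ⟨
      dot N x (A i)  ≈⟨ ⟨⟩-comm (x ∘ toℕ {N}) (A i ∘ toℕ) ⟩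
      dot N (A i) x  ≈⟨ Ax≈1 i i<N ⟩
      1#             ∎)

    -- The row operation is undone by adding `s` times row `k` back, which transports `annihilates`
    -- and `onto`. Earlier orthogonality persists because both rows are already orthogonal to each
    -- row before `k`. As `annihilates` concerns the rows below `m`, the pivot row has to be one of
    -- them.
    reduce-row : ∀ {A A′ k j s} → k ℕ.< m → k ℕ.< j →
      (∀ i → i ≢ j → ∀ l → A′ i l ≡ A i l) →
      (∀ l → l ℕ.< N → A′ j l ≈ A j l - s * A k l) →
      s * dot N (A k) (A k) ≈ dot N (A j) (A k) →
      Partial m B A k j → Partial m B A′ k (suc j)
    reduce-row {A} {A′} {k} {j} {s} k<m k<j same changed s-norm p = record
      { annihilates    = annihilates′
      ; onto           = onto′
      ; orthogonal     = orthogonal′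
      ; orthogonal-row = orthogonal-row′
      }
      where
      dot-same : ∀ i → i ≢ j → ∀ x → dot N (A′ i) x ≈ dot N (A i) x
      dot-same i i≢j x = dot-congˡ N x λ l _ → reflexive (same i i≢j l)

      dot-changed : ∀ x → dot N (A′ j) x ≈ dot N (A j) x - s * dot N (A k) x
      dot-changed x = begin
        dot N (A′ j) x
          ≈⟨ dot-congˡ N x (λ l l<N → trans (changed l l<N)
               (solve 3 (λ a s b → a :- s :* b := a :+ (:- s) :* b) refl (A j l) s (A k l))) ⟩
        ⟨ (A j ∘ toℕ) ⊕ (- s) · (A k ∘ toℕ) , x ∘ toℕ {N} ⟩
          ≈⟨ ⟨⟩-linearˡ (A j ∘ toℕ {N}) (A k ∘ toℕ) (x ∘ toℕ) (- s) ⟩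
        dot N (A j) x + - s * dot N (A k) x
          ≈⟨ solve 3 (λ a s b → a :+ (:- s) :* b := a :- s :* b) refl (dot N (A j) x) s (dot N (A k) x) ⟩
        dot N (A j) x - s * dot N (A k) x ∎

      dot-restored : ∀ x → dot N (A j) x ≈ dot N (A′ j) x + s * dot N (A k) x
      dot-restored x = begin
        dot N (A j) x
          ≈⟨ solve 2 (λ a b → a := a :- b :+ b) refl (dot N (A j) x) (s * dot N (A k) x) ⟩
        dot N (A j) x - s * dot N (A k) x + s * dot N (A k) x
          ≈⟨ +-congʳ (dot-changed x) ⟨
        dot N (A′ j) x + s * dot N (A k) x ∎

      k≢j : k ≢ j
      k≢j = ℕₚ.<⇒≢ k<j

      dot-cong : ∀ i l → l ≢ j → dot N (A′ i) (A′ l) ≈ dot N (A′ i) (A l)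
      dot-cong i l l≢j = ⟨⟩-cong {x = A′ i ∘ toℕ {N}} (λ _ → refl) (λ t → reflexive (same l l≢j (toℕ t)))

      annihilates′ : ∀ x → (∀ i → i ℕ.< m → dot N (A′ i) x ≈ 0#) →
        ∀ i → i ℕ.< m → dot N (B i) x ≈ 0#
      annihilates′ x A′x≈0 = annihilates p x Ax≈0
        where
        Ax≈0 : ∀ i → i ℕ.< m → dot N (A i) x ≈ 0#
        Ax≈0 i i<m with i ℕₚ.≟ j
        ... | no i≢j = trans (sym (dot-same i i≢j x)) (A′x≈0 i i<m)
        ... | yes ≡.refl = begin
          dot N (A i) x                        ≈⟨ dot-restored x ⟩
          dot N (A′ i) x + s * dot N (A k) x
            ≈⟨ +-cong (A′x≈0 i i<m) (*-congˡ (trans (sym (dot-same k k≢j x)) (A′x≈0 k k<m))) ⟩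
          0# + s * 0#                          ≈⟨ trans (+-identityˡ _) (*-zeroʳ s) ⟩
          0#                                   ∎

      onto′ : ∀ (b : ℕ → Carrier) → ∃[ x ] (∀ i → i ℕ.< N → dot N (A′ i) x ≈ b i)
      onto′ b = x , A′x≈b
        where
        b′ : ℕ → Carrier
        -- Row `j` must yield `b j` after losing `s` times row `k`, so the old row is asked for
        -- correspondingly more.
        b′ i = if ⌊ i ℕₚ.≟ j ⌋ then b j + s * b k else b i

        b′-same : ∀ i → i ≢ j → b′ i ≡ b i
        b′-same i i≢j with i ℕₚ.≟ j
        ... | yes i≡j = contradiction i≡j i≢j
        ... | no  _   = ≡.refl

        b′-changed : b′ j ≡ b j + s * b k
        b′-changed with j ℕₚ.≟ j
        ... | yes _  = ≡.refl
        ... | no j≢j = contradiction ≡.refl j≢j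

        x : ℕ → Carrier
        x = proj₁ (onto p b′)

        Ax≈b′ : ∀ i → i ℕ.< N → dot N (A i) x ≈ b′ i
        Ax≈b′ = proj₂ (onto p b′)

        A′x≈b : ∀ i → i ℕ.< N → dot N (A′ i) x ≈ b i
        A′x≈b i i<N with i ℕₚ.≟ j
        ... | no i≢j = trans (dot-same i i≢j x) (trans (Ax≈b′ i i<N) (reflexive (b′-same i i≢j)))
        ... | yes ≡.refl = begin
          dot N (A′ i) x                      ≈⟨ dot-changed x ⟩
          dot N (A i) x - s * dot N (A k) x
            ≈⟨ +-cong (trans (Ax≈b′ i i<N) (reflexive b′-changed))
                 (-‿cong (*-congˡ (trans (Ax≈b′ k (ℕₚ.<-trans k<m (ℕₚ.n<1+n m))) (reflexive (b′-same k k≢j))))) ⟩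
          b i + s * b k - s * b k             ≈⟨ solve 2 (λ a b → a :+ b :- b := a) refl (b i) (s * b k) ⟩
          b i                                 ∎

      orthogonal′ : ∀ i l → i ℕ.< N → l ℕ.< k → l ℕ.< i → dot N (A′ i) (A′ l) ≈ 0#
      orthogonal′ i l i<N l<k l<i = trans (dot-cong i l (ℕₚ.<⇒≢ (ℕₚ.<-trans l<k k<j))) A′A≈0
        where
        A′A≈0 : dot N (A′ i) (A l) ≈ 0#
        A′A≈0 with i ℕₚ.≟ j
        ... | no i≢j = trans (dot-same i i≢j (A l)) (orthogonal p i l i<N l<k l<i)
        ... | yes ≡.refl = begin
          dot N (A′ i) (A l)
            ≈⟨ dot-changed (A l) ⟩
          dot N (A i) (A l) - s * dot N (A k) (A l)
            ≈⟨ +-cong (orthogonal p i l i<N l<k l<i)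
                 (-‿cong (*-congˡ (orthogonal p k l (ℕₚ.<-trans k<m (ℕₚ.n<1+n m)) l<k l<k))) ⟩
          0# - s * 0#
            ≈⟨ solve 1 (λ s → con (+ 0) :- s :* con (+ 0) := con (+ 0)) refl s ⟩
          0# ∎

      orthogonal-row′ : ∀ i → i ℕ.< N → i ℕ.< suc j → k ℕ.< i → dot N (A′ i) (A′ k) ≈ 0#
      orthogonal-row′ i i<N i<1+j k<i = trans (dot-cong i k k≢j) A′A≈0
        where
        A′A≈0 : dot N (A′ i) (A k) ≈ 0#
        A′A≈0 with i ℕₚ.≟ j
        ... | no i≢j = trans (dot-same i i≢j (A k))
          (orthogonal-row p i i<N (ℕₚ.≤∧≢⇒< (ℕ.s≤s⁻¹ i<1+j) i≢j) k<i)
        ... | yes ≡.refl = begin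
          dot N (A′ i) (A k)                         ≈⟨ dot-changed (A k) ⟩
          dot N (A i) (A k) - s * dot N (A k) (A k)  ≈⟨ +-congˡ (-‿cong s-norm) ⟩
          dot N (A i) (A k) - dot N (A i) (A k)      ≈⟨ -‿inverseʳ _ ⟩
          0#                                         ∎

    -- Orthogonality to the reduced rows is membership in their kernel, which `annihilates` takes
    -- back to the original rows.
    last-row : ∀ {A} → Partial m B A m 0 → ∀ i → i ℕ.< m → dot N (B i) (A m) ≈ 0#
    last-row {A} p = annihilates p (A m) λ i i<m →
      trans (⟨⟩-comm (A i ∘ toℕ {N}) (A m ∘ toℕ)) (orthogonal p m i (ℕₚ.n<1+n m) i<m i<m)

  -- The bordered matrix and the homogenised system

  module BorderedSystem {m} (M : Matrix m m) (q u : Vec m)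
    (0≤u : Nonneg u) (nonsingular : Nonsingular (principal M (support u))) where

    private
      N : ℕ
      N = suc m

    extend : Vec m → Carrier → ℕ → Carrier
    extend x a k with k ℕₚ.<? m
    ... | yes k<m = x (fromℕ< k<m)
    ... | no  _   = a

    extend-toℕ : ∀ x a i → extend x a (toℕ i) ≡ x i
    extend-toℕ x a i with toℕ i ℕₚ.<? m
    ... | yes i<m = ≡.cong x (Fin.fromℕ<-toℕ i i<m)
    ... | no  i≮m = contradiction (Fin.toℕ<n i) i≮m

    extend-m : ∀ x a → extend x a m ≡ a
    extend-m x a with m ℕₚ.<? m
    ... | yes m<m = contradiction m<m (ℕₚ.n≮n m)
    ... | no  _   = ≡.refl

    pad-toℕ : ∀ {n} (x : Vec n) i → pad x (toℕ i) ≡ x i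
    pad-toℕ {n} x i with toℕ i ℕₚ.<? n
    ... | yes i<n = ≡.cong x (Fin.fromℕ<-toℕ i i<n)
    ... | no  i≮n = contradiction (Fin.toℕ<n i) i≮n

    pad-m : ∀ (x : Vec m) → pad x m ≡ 0#
    pad-m x with m ℕₚ.<? m
    ... | yes m<m = contradiction m<m (ℕₚ.n≮n m)
    ... | no  _   = ≡.refl

    padMatrix-toℕ : ∀ i j → padMatrix M (toℕ i) (toℕ j) ≡ M i j
    padMatrix-toℕ i j with toℕ i ℕₚ.<? m
    ... | yes i<m = ≡.trans (≡.cong (λ k → pad (M k) (toℕ j)) (Fin.fromℕ<-toℕ i i<m)) (pad-toℕ (M i) j)
    ... | no  i≮m = contradiction (Fin.toℕ<n i) i≮m

    δ : ℕ → ℕ → Carrier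
    δ i j = if ⌊ i ℕₚ.≟ j ⌋ then 1# else 0#

    -- Row i is (Mᵢ , qᵢ) for i in the support of u and a unit vector otherwise;
    -- column m carries the constant term.
    bordered : Rows
    bordered i j =
      if ⌊ pad u i ≤? 0# ⌋ then δ i j
      else (if ⌊ j ℕₚ.≟ m ⌋ then pad q i else padMatrix M i j)

    δ-suc : ∀ i j → δ (suc i) (suc j) ≡ δ i j
    δ-suc i j = ≡.cong (λ b → if b then 1# else 0#)
      (≡.trans (isYes≗does (suc i ℕₚ.≟ suc j)) (≡.sym (isYes≗does (i ℕₚ.≟ j))))

    dot-δ : ∀ {n} i x → i ℕ.< n → dot n (δ i) x ≈ x i
    dot-δ {suc n} zero x z<s = trans
      (+-cong (*-identityˡ (x 0)) (sum-≈0 {n} λ l → *-zeroˡ (x (suc (toℕ l))))) (+-identityʳ _)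
    dot-δ {suc n} (suc i) x (s<s i<n) = begin
      0# * x 0 + dot n (δ (suc i) ∘ suc) (x ∘ suc)
        ≈⟨ +-cong (*-zeroˡ (x 0)) (dot-congˡ n (x ∘ suc) (λ l _ → reflexive (δ-suc i l))) ⟩
      0# + dot n (δ i) (x ∘ suc)
        ≈⟨ trans (+-identityˡ _) (dot-δ i (x ∘ suc) i<n) ⟩
      x (suc i) ∎

    row-off : ∀ i → i ℕ.< N → pad u i ≤ 0# → ∀ x → dot N (bordered i) x ≈ x i
    row-off i i<N uᵢ≤0 x = trans (dot-congˡ N x (λ l _ → reflexive (row l))) (dot-δ i x i<N)
      where
      row : ∀ l → bordered i l ≡ δ i l
      row l with pad u i ≤? 0#
      ... | yes _   = ≡.refl
      ... | no uᵢ≰0 = contradiction uᵢ≤0 uᵢ≰0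

    row-on : ∀ i → 0# < u i → ∀ x →
      dot N (bordered (toℕ i)) x ≈ (M ⊛ (x ∘ toℕ)) i + q i * x m
    row-on i (0≤uᵢ , 0≉uᵢ) x = begin
      dot N (bordered (toℕ i)) x
        ≈⟨ sum-snoc m (λ l → bordered (toℕ i) l * x l) ⟩
      sum {m} (λ j → bordered (toℕ i) (toℕ j) * x (toℕ j)) + bordered (toℕ i) m * x m
        ≈⟨ +-cong (sum-cong-≋ λ j → *-congʳ (reflexive (inner j))) (*-congʳ (reflexive border)) ⟩
      (M ⊛ (x ∘ toℕ)) i + q i * x m ∎
      where
      uᵢ≰0 : ¬ pad u (toℕ i) ≤ 0#
      uᵢ≰0 uᵢ≤0 = 0≉uᵢ (antisym 0≤uᵢ (≡.subst (_≤ 0#) (pad-toℕ u i) uᵢ≤0))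

      inner : ∀ j → bordered (toℕ i) (toℕ j) ≡ M i j
      inner j with pad u (toℕ i) ≤? 0# | toℕ j ℕₚ.≟ m
      ... | yes uᵢ≤0 | _       = contradiction uᵢ≤0 uᵢ≰0
      ... | no _     | yes j≡m = contradiction j≡m (ℕₚ.<⇒≢ (Fin.toℕ<n j))
      ... | no _     | no _    = padMatrix-toℕ i j

      border : bordered (toℕ i) m ≡ q i
      border with pad u (toℕ i) ≤? 0# | m ℕₚ.≟ m
      ... | yes uᵢ≤0 | _      = contradiction uᵢ≤0 uᵢ≰0
      ... | no _     | yes _  = pad-toℕ q i
      ... | no _     | no m≢m = contradiction ≡.refl m≢m

    off⇒≤0 : ∀ i → ¬ 0# < u i → pad u (toℕ i) ≤ 0#
    off⇒≤0 i uᵢ≯0 = ≡.subst (_≤ 0#) (≡.sym (pad-toℕ u i)) (≤-reflexive (nonNeg∧≯0⇒≈0 (0≤u i) uᵢ≯0))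

    data Index : ℕ → Set where
      inner  : (i : Fin m) → Index (toℕ i)
      border : Index m

    classify : ∀ {i} → i ℕ.< N → Index i
    classify {i} i<N with ℕₚ.m≤n⇒m<n∨m≡n (ℕ.s≤s⁻¹ i<N)
    ... | inj₁ i<m    = ≡.subst Index (Fin.toℕ-fromℕ< i<m) (inner (fromℕ< i<m))
    ... | inj₂ ≡.refl = border

    -- The unit rows prescribe the last coordinate and those off the support, carried by `b m` and
    -- `y`. A system for M_αα remains, whose right-hand side `r` has the contribution of the
    -- prescribed coordinates removed.
    bordered-onto : ∀ (b : ℕ → Carrier) → ∃[ x ] (∀ i → i ℕ.< N → dot N (bordered i) x ≈ b i)
    bordered-onto b = x , λ i i<N → Bx≈b (classify i<N)
      where
      y : Vec m
      y i = if ⌊ 0# <? u i ⌋ then 0# else b (toℕ i)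

      r : Vec m
      r i = b (toℕ i) - q i * b m - (M ⊛ y) i

      solution : ∃[ x ] (∀ i → ¬ 0# < u i → x i ≈ 0#) × (∀ i → 0# < u i → (M ⊛ x) i ≈ r i)
      solution = principal-solve (λ i → 0# <? u i) M nonsingular r

      x′ : Vec m
      x′ = proj₁ solution

      x : ℕ → Carrier
      x = extend (y ⊕ 1# · x′) (b m)

      y-off : ∀ i → ¬ 0# < u i → y i ≡ b (toℕ i)
      y-off i uᵢ≯0 with 0# <? u i
      ... | yes 0<uᵢ = contradiction 0<uᵢ uᵢ≯0
      ... | no  _    = ≡.refl

      Bx≈b-inner : ∀ i → Dec (0# < u i) → dot N (bordered (toℕ i)) x ≈ b (toℕ i)
      Bx≈b-inner i (yes 0<uᵢ) = begin
        dot N (bordered (toℕ i)) x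
          ≈⟨ row-on i 0<uᵢ x ⟩
        (M ⊛ (x ∘ toℕ)) i + q i * x m
          ≈⟨ +-cong (⟨⟩-cong (λ _ → refl) (λ j → reflexive (extend-toℕ _ (b m) j)))
               (*-congˡ (reflexive (extend-m _ (b m)))) ⟩
        ⟨ M i , y ⊕ 1# · x′ ⟩ + q i * b m
          ≈⟨ +-congʳ (trans (⟨⟩-linearʳ (M i) y x′ 1#) (+-congˡ (*-congˡ (proj₂ (proj₂ solution) i 0<uᵢ)))) ⟩
        (M ⊛ y) i + 1# * r i + q i * b m
          ≈⟨ solve 3 (λ b q y → y :+ con (+ 1) :* (b :- q :- y) :+ q := b) refl (b (toℕ i)) (q i * b m) ((M ⊛ y) i) ⟩
        b (toℕ i) ∎
      Bx≈b-inner i (no uᵢ≯0) = begin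
        dot N (bordered (toℕ i)) x
          ≈⟨ row-off (toℕ i) (ℕₚ.<-trans (Fin.toℕ<n i) (ℕₚ.n<1+n m)) (off⇒≤0 i uᵢ≯0) x ⟩
        x (toℕ i)
          ≈⟨ reflexive (extend-toℕ _ (b m) i) ⟩
        y i + 1# * x′ i
          ≈⟨ +-cong (reflexive (y-off i uᵢ≯0)) (*-congˡ (proj₁ (proj₂ solution) i uᵢ≯0)) ⟩
        b (toℕ i) + 1# * 0#
          ≈⟨ trans (+-congˡ (*-zeroʳ 1#)) (+-identityʳ _) ⟩
        b (toℕ i) ∎

      Bx≈b : ∀ {i} → Index i → dot N (bordered i) x ≈ b i
      Bx≈b border = trans (row-off m (ℕₚ.n<1+n m) (≤-reflexive (reflexive (pad-m u))) x)
        (reflexive (extend-m _ (b m)))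
      Bx≈b (inner i) = Bx≈b-inner i (0# <? u i)

    module _ (h : ℕ → Carrier) (norm≉0 : ¬ dot N h h ≈ 0#)
      (Bh≈0 : ∀ i → i ℕ.< m → dot N (bordered i) h ≈ 0#) where

      private
        h-off : ∀ i → ¬ 0# < u i → h (toℕ i) ≈ 0#
        h-off i uᵢ≯0 = trans
          (sym (row-off (toℕ i) (ℕₚ.<-trans (Fin.toℕ<n i) (ℕₚ.n<1+n m)) (off⇒≤0 i uᵢ≯0) h))
          (Bh≈0 (toℕ i) (Fin.toℕ<n i))

        h-on : ∀ i → 0# < u i → (M ⊛ (h ∘ toℕ)) i + q i * h m ≈ 0#
        h-on i 0<uᵢ = trans (sym (row-on i 0<uᵢ h)) (Bh≈0 (toℕ i) (Fin.toℕ<n i))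

      -- Without its last coordinate, `h` would solve the homogeneous system for M_αα and vanish off
      -- α, hence vanish altogether, against its nonzero norm.
      hₘ≉0 : ¬ h m ≈ 0#
      hₘ≉0 hₘ≈0 = norm≉0 (⟨⟩-zeroʳ (h ∘ toℕ) (λ i → h≈0 (classify (Fin.toℕ<n i))))
        where
        Mh≈0 : ∀ i → 0# < u i → (M ⊛ (h ∘ toℕ)) i ≈ 0#
        Mh≈0 i 0<uᵢ = begin
          (M ⊛ (h ∘ toℕ)) i               ≈⟨ +-identityʳ _ ⟨
          (M ⊛ (h ∘ toℕ)) i + 0#          ≈⟨ +-congˡ (trans (*-congˡ hₘ≈0) (*-zeroʳ (q i))) ⟨
          (M ⊛ (h ∘ toℕ)) i + q i * h m   ≈⟨ h-on i 0<uᵢ ⟩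
          0#                              ∎

        h≈0 : ∀ {i} → Index i → h i ≈ 0#
        h≈0 border    = hₘ≈0
        h≈0 (inner i) = principal-injective (λ i → 0# <? u i) M nonsingular (h ∘ toℕ) h-off Mh≈0 i

      module _ (x : Vec m) (x≋ : ∀ i → x i ≈ h (toℕ i) ÷ h m) where

        private
          xhₘ≈h : ∀ i → x i * h m ≈ h (toℕ i)
          xhₘ≈h i = trans (*-congʳ (x≋ i)) (÷-* (h (toℕ i)) hₘ≉0)

        x-off : ∀ i → ¬ 0# < u i → x i ≈ 0#
        x-off i uᵢ≯0 = *-≈0 (trans (xhₘ≈h i) (h-off i uᵢ≯0)) hₘ≉0

        x-on : ∀ i → 0# < u i → q i + (M ⊛ x) i ≈ 0#
        -- Multiplication by `h m` clears the denominators and leaves row `i` of the homogenised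
        -- system.
        x-on i 0<uᵢ = *-≈0 scaled hₘ≉0
          where
          scaled : (q i + (M ⊛ x) i) * h m ≈ 0#
          scaled = begin
            (q i + (M ⊛ x) i) * h m
              ≈⟨ solve 3 (λ q a h → (q :+ a) :* h := a :* h :+ q :* h) refl (q i) ((M ⊛ x) i) (h m) ⟩
            (M ⊛ x) i * h m + q i * h m
              ≈⟨ +-congʳ (*-distribʳ-sum (h m) (λ j → M i j * x j)) ⟩
            sum (λ j → M i j * x j * h m) + q i * h m
              ≈⟨ +-congʳ (sum-cong-≋ λ j → trans
                   (solve 3 (λ a x h → a :* x :* h := a :* (x :* h)) refl (M i j) (x j) (h m))
                   (*-congˡ (xhₘ≈h j))) ⟩
            (M ⊛ (h ∘ toℕ)) i + q i * h m
              ≈⟨ h-on i 0<uᵢ ⟩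
            0# ∎

  -- Memory, frames and rules for loops and branches

  setReg-other : ∀ {i r} k σ → i ≢ r → reg (setReg i k σ) r ≡ reg σ r
  setReg-other {i} {r} k σ i≢r with i ℕₚ.≟ r
  ... | yes i≡r = contradiction i≡r i≢r
  ... | no  _   = ≡.refl

  write-other : ∀ {a b} i j v σ → a ≢ b → ∀ k l → mem (write (at a i j) v σ) b k l ≡ mem σ b k l
  write-other {a} {b} i j v σ a≢b k l with a ℕₚ.≟ b
  ... | yes a≡b = contradiction a≡b a≢b
  ... | no  _   = ≡.refl

  write-hit : ∀ a i j v σ {x y} → reg σ i ≡ x → reg σ j ≡ y → mem (write (at a i j) v σ) a x y ≡ v
  write-hit a i j v σ ≡.refl ≡.refl
    with a ℕₚ.≟ a | reg σ i ℕₚ.≟ reg σ i | reg σ j ℕₚ.≟ reg σ j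
  ... | yes _  | yes _  | yes _  = ≡.refl
  ... | no a≢a | _      | _      = contradiction ≡.refl a≢a
  ... | yes _  | no i≢i | _      = contradiction ≡.refl i≢i
  ... | yes _  | yes _  | no j≢j = contradiction ≡.refl j≢j

  write-miss : ∀ a i j v σ {x y} → reg σ i ≡ x → reg σ j ≡ y →
    ∀ k l → ¬ (k ≡ x × l ≡ y) → mem (write (at a i j) v σ) a k l ≡ mem σ a k l
  write-miss a i j v σ ≡.refl ≡.refl k l kl≢xy
    with a ℕₚ.≟ a | reg σ i ℕₚ.≟ k | reg σ j ℕₚ.≟ l
  ... | yes _ | yes i≡k | yes j≡l = contradiction (≡.sym i≡k , ≡.sym j≡l) kl≢xy
  ... | yes _ | yes _   | no _    = ≡.refl
  ... | yes _ | no _    | _       = ≡.refl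
  ... | no _  | _       | _       = ≡.refl

  read-at : ∀ {σ a i j x y} → reg σ i ≡ x → reg σ j ≡ y → read σ (at a i j) ≡ mem σ a x y
  read-at ≡.refl ≡.refl = ≡.refl

  record Frame (P : Program) (σ τ : State) : Set c where
    field
      reg≡ : ∀ r → {KeepsRegister r P} → reg τ r ≡ reg σ r
      mem≡ : ∀ a → {KeepsArray a P} → ∀ x y → mem τ a x y ≡ mem σ a x y

  open Frame public

  mutual
    run-frame : ∀ P σ → Frame P σ (run P σ)
    run-frame skip σ = record { reg≡ = λ _ → ≡.refl ; mem≡ = λ _ _ _ → ≡.refl }
    run-frame (P ⨾ Q) σ = record
      { reg≡ = λ r {keeps} → ≡.trans (reg≡ Q-frame r {proj₂ keeps}) (reg≡ P-frame r {proj₁ keeps})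
      ; mem≡ = λ a {keeps} x y →
          ≡.trans (mem≡ Q-frame a {proj₂ keeps} x y) (mem≡ P-frame a {proj₁ keeps} x y)
      }
      where
      P-frame = run-frame P σ
      Q-frame = run-frame Q (run P σ)
    run-frame (assign (at b i j) t) σ = record
      { reg≡ = λ _ → ≡.refl
      ; mem≡ = λ _ {b≢a} → write-other i j (eval σ t) σ (toWitnessFalse b≢a)
      }
    run-frame (zeroʳ i) σ = record
      { reg≡ = λ _ {i≢r} → setReg-other _ σ (toWitnessFalse i≢r) ; mem≡ = λ _ _ _ → ≡.refl }
    run-frame (sucʳ i) σ = record
      { reg≡ = λ _ {i≢r} → setReg-other _ σ (toWitnessFalse i≢r) ; mem≡ = λ _ _ _ → ≡.refl }
    run-frame (copyʳ i j) σ = record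
      { reg≡ = λ _ {i≢r} → setReg-other _ σ (toWitnessFalse i≢r) ; mem≡ = λ _ _ _ → ≡.refl }
    run-frame (branch t P Q) σ with holds σ t
    ... | true = record
      { reg≡ = λ r {keeps} → reg≡ (run-frame P σ) r {proj₁ keeps}
      ; mem≡ = λ a {keeps} → mem≡ (run-frame P σ) a {proj₁ keeps}
      }
    ... | false = record
      { reg≡ = λ r {keeps} → reg≡ (run-frame Q σ) r {proj₂ keeps}
      ; mem≡ = λ a {keeps} → mem≡ (run-frame Q σ) a {proj₂ keeps}
      }
    run-frame (for i n P) σ = iterate-frame i n P σ (reg σ n)

    -- Stated for every number of passes, not only the one read from register `n`, because
    -- invariants need the frame in the middle of a loop.
    iterate-frame : ∀ i n P σ k →
      Frame (for i n P) σ (iterate (λ l τ → run P (setReg i l τ)) k σ)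
    iterate-frame i n P σ zero = record { reg≡ = λ _ → ≡.refl ; mem≡ = λ _ _ _ → ≡.refl }
    iterate-frame i n P σ (suc k) = record
      { reg≡ = λ r {keeps} → ≡.trans (reg≡ P-frame r {proj₂ keeps})
          (≡.trans (setReg-other k (iterate (λ l τ → run P (setReg i l τ)) k σ) (toWitnessFalse (proj₁ keeps)))
            (reg≡ previous r {keeps}))
      ; mem≡ = λ a {keeps} x y → ≡.trans (mem≡ P-frame a {keeps} x y) (mem≡ previous a {keeps} x y)
      }
      where
      previous = iterate-frame i n P σ k
      P-frame = run-frame P (setReg i k (iterate (λ l τ → run P (setReg i l τ)) k σ))

  -- An opaque copy of run: unfolding run on concrete programs while comparing
  -- terms takes exponential time.
  opaque
    exec : Program → State → State
    exec = run

  opaque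
    unfolding exec

    exec≡run : ∀ P σ → exec P σ ≡ run P σ
    exec≡run P σ = ≡.refl

    exec-skip : ∀ σ → exec skip σ ≡ σ
    exec-skip σ = ≡.refl

    exec-⨾ : ∀ P Q σ → exec (P ⨾ Q) σ ≡ exec Q (exec P σ)
    exec-⨾ P Q σ = ≡.refl

    exec-assign : ∀ a i j t σ {x y} → reg σ i ≡ x → reg σ j ≡ y →
      mem (exec (assign (at a i j) t) σ) a x y ≡ eval σ t
    exec-assign a i j t σ = write-hit a i j (eval σ t) σ

    exec-frame : ∀ P σ → Frame P σ (exec P σ)
    exec-frame = run-frame

    -- The step receives the frame from the start of the loop, so `Inv` has to mention only what the
    -- body changes.
    for-invariant : ∀ {ℓ} i n P σ {N} → reg σ n ≡ N → (Inv : ℕ → State → Set ℓ) → Inv 0 σ →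
      (∀ k τ → k ℕ.< N → Frame (for i n P) σ τ → Inv k τ → Inv (suc k) (exec P (setReg i k τ))) →
      Inv N (exec (for i n P) σ)
    for-invariant i n P σ ≡.refl Inv base step = go (reg σ n) ℕₚ.≤-refl
      where
      go : ∀ k → k ℕ.≤ reg σ n → Inv k (iterate (λ l τ → run P (setReg i l τ)) k σ)
      go zero    _   = base
      go (suc k) k<n = step k _ k<n (iterate-frame i n P σ k) (go k (ℕₚ.<⇒≤ k<n))

    -- Any decision with the same Boolean may replace the test, so that a comparison of machine
    -- contents becomes one of mathematical values.
    branch-rule : ∀ {a ℓ} {A : Set a} {t P Q σ} (A? : Dec A) → holds σ t ≡ ⌊ A? ⌋ → (Φ : State → Set ℓ) →
      (A → Φ (exec P σ)) → (¬ A → Φ (exec Q σ)) → Φ (exec (branch t P Q) σ)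
    branch-rule {A = A} {t} {P} {Q} {σ} A? t≡A? Φ on-yes on-no =
      ≡.subst (λ b → Φ (if b then run P σ else run Q σ)) (≡.sym t≡A?) (decided A?)
      where
      decided : (A? : Dec A) → Φ (if ⌊ A? ⌋ then run P σ else run Q σ)
      decided (yes a) = on-yes a
      decided (no ¬a) = on-no ¬a

  -- Polynomial bound on the cost

  -- Every loop count is read from `r` or `s`, and both keep their contents, so each count met
  -- during the run, however deeply nested, is at most `N`.
  cost-bounded : ∀ {r s N} P σ → LoopsOver r s P → reg σ r ℕ.≤ N → reg σ s ℕ.≤ N →
    KeepsRegister r P → KeepsRegister s P → cost P σ ℕ.≤ evalPoly (costBound P) N
  cost-bounded skip σ _ _ _ _ _ = ℕ.z≤n
  cost-bounded {r} {s} {N} (P ⨾ Q) σ (loopsP , loopsQ) r≤N s≤N (rP , rQ) (sP , sQ) =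
    ℕₚ.≤-trans
      (ℕₚ.+-mono-≤ (cost-bounded P σ loopsP r≤N s≤N rP sP)
        (cost-bounded Q (run P σ) loopsQ
          (≡.subst (ℕ._≤ N) (≡.sym (reg≡ (run-frame P σ) r {rP})) r≤N)
          (≡.subst (ℕ._≤ N) (≡.sym (reg≡ (run-frame P σ) s {sP})) s≤N) rQ sQ))
      (ℕₚ.≤-reflexive (≡.sym (evalPoly-⊞ (costBound P) (costBound Q) N)))
  cost-bounded {N = N} (branch t P Q) σ (loopsP , loopsQ) r≤N s≤N (rP , rQ) (sP , sQ)
    rewrite evalPoly-⊞ List.[ 1 ] (costBound P ⊞ costBound Q) N
          | evalPoly-⊞ (costBound P) (costBound Q) N
          | ℕₚ.*-zeroʳ N
    with holds σ t
  ... | true  = ℕ.s≤s (ℕₚ.≤-trans (cost-bounded P σ loopsP r≤N s≤N rP sP) (ℕₚ.m≤m+n _ _))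
  ... | false = ℕ.s≤s (ℕₚ.≤-trans (cost-bounded Q σ loopsQ r≤N s≤N rQ sQ) (ℕₚ.m≤n+m _ _))
  cost-bounded {r} {s} {N} (for i n P) σ (n∈ , i≢r , i≢s , rP , sP , loops) r≤N s≤N _ _
    rewrite evalPoly-⊞ List.[ 1 ] (costBound P) N | ℕₚ.*-zeroʳ N =
    ℕₚ.≤-trans (ℕₚ.≤-reflexive (cost≡passes (reg σ n) ≡.refl))
      (ℕₚ.≤-trans (loop-cost-bounded passes _ ≡.refl (λ _ → ≡.refl) body (reg σ n))
        (ℕ.s≤s (ℕₚ.*-monoˡ-≤ (suc (evalPoly (costBound P) N)) n≤N)))
    where
    -- The local function in the definition of cost has no name outside it;
    -- unification recovers it from the next equation.
    passes : ℕ → ℕ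
    passes = _

    cost≡passes : ∀ k → reg σ n ≡ k → cost (for i n P) σ ≡ passes k
    cost≡passes k n≡k rewrite n≡k = ≡.refl

    n≤N : reg σ n ℕ.≤ N
    n≤N with n ℕₚ.≟ r | n ℕₚ.≟ s
    ... | yes ≡.refl | _          = r≤N
    ... | no _       | yes ≡.refl = s≤N
    ... | no _       | no _       = contradiction n∈ λ ()

    body : ∀ k → cost P (setReg i k (iterate (λ l τ → run P (setReg i l τ)) k σ))
      ℕ.≤ evalPoly (costBound P) N
    body k = cost-bounded P _ loops (kept r i≢r rP r≤N) (kept s i≢s sP s≤N) rP sP
      where
      kept : ∀ t → False (i ℕₚ.≟ t) → KeepsRegister t P → reg σ t ℕ.≤ N →
        reg (setReg i k (iterate (λ l τ → run P (setReg i l τ)) k σ)) t ℕ.≤ N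
      kept t i≢t tP t≤N = ≡.subst (ℕ._≤ N)
        (≡.sym (≡.trans
          (setReg-other k (iterate (λ l τ → run P (setReg i l τ)) k σ) (toWitnessFalse i≢t))
          (reg≡ (iterate-frame i n P σ k) t {i≢t , tP}))) t≤N
  cost-bounded {N = N} (assign _ _) σ _ _ _ _ _ = ℕ.s≤s ℕ.z≤n
  cost-bounded {N = N} (zeroʳ _)    σ _ _ _ _ _ = ℕ.s≤s ℕ.z≤n
  cost-bounded {N = N} (sucʳ _)     σ _ _ _ _ _ = ℕ.s≤s ℕ.z≤n
  cost-bounded {N = N} (copyʳ _ _)  σ _ _ _ _ _ = ℕ.s≤s ℕ.z≤n

  -- Programs that fill an array entry by entry

  record Sets (P : Program) (σ : State) (a : Array) (x y : ℕ) (v : Carrier) : Set (c ⊔ ℓ₁) where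
    field
      hit  : mem (exec P σ) a x y ≈ v
      miss : ∀ k l → ¬ (k ≡ x × l ≡ y) → mem (exec P σ) a k l ≡ mem σ a k l

  open Sets public

  opaque
    unfolding exec

    sets-assign : ∀ {a i j t σ x y v} → reg σ i ≡ x → reg σ j ≡ y → eval σ t ≈ v →
      Sets (assign (at a i j) t) σ a x y v
    sets-assign {a} {i} {j} {t} {σ} i≡x j≡y t≈v = record
      { hit  = trans (reflexive (write-hit a i j (eval σ t) σ i≡x j≡y)) t≈v
      ; miss = write-miss a i j (eval σ t) σ i≡x j≡y
      }

    sets-⨾ : ∀ {P Q σ a x y v} → {keeps : KeepsArray a P} → Sets Q (exec P σ) a x y v → Sets (P ⨾ Q) σ a x y v
    sets-⨾ {P} {σ = σ} {a = a} {keeps = keeps} sets = record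
      { hit  = hit sets
      ; miss = λ k l kl≢xy → ≡.trans (miss sets k l kl≢xy) (mem≡ (exec-frame P σ) a {keeps} k l)
      }

    -- The test stays inside the value as a Boolean conditional, the same shape as in `bordered`, so
    -- the two can be compared without deciding it.
    sets-branch : ∀ {t P Q σ a x y v w} → Sets P σ a x y v → Sets Q σ a x y w →
      Sets (branch t P Q) σ a x y (if holds σ t then v else w)
    sets-branch {t} {P} {Q} {σ} {a} {x} {y} {v} {w} sets-P sets-Q = record
      { hit = branch-hit (holds σ t) ; miss = branch-miss (holds σ t) }
      where
      branch-hit : ∀ b → mem (if b then exec P σ else exec Q σ) a x y ≈ (if b then v else w)
      branch-hit true  = hit sets-P
      branch-hit false = hit sets-Q

      branch-miss : ∀ b k l → ¬ (k ≡ x × l ≡ y) → mem (if b then exec P σ else exec Q σ) a k l ≡ mem σ a k l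
      branch-miss true  = miss sets-P
      branch-miss false = miss sets-Q

  sets-value : ∀ {P σ a x y v w} → v ≡ w → Sets P σ a x y v → Sets P σ a x y w
  sets-value ≡.refl sets = sets

  module _ {i n : Register} {P : Program} {σ : State} {N : ℕ} {a : Array} {row col : ℕ → ℕ} {v : ℕ → Carrier} where

    Untouched : ℕ → State → Set c
    Untouched k τ = ∀ x y → (∀ l → l ℕ.< k → ¬ (x ≡ row l × y ≡ col l)) → mem τ a x y ≡ mem σ a x y

    -- Distinct passes write distinct positions, so nothing written is overwritten later; each pass
    -- may also rely on the entries not yet reached being old.
    for-sets : reg σ n ≡ N → (∀ {k l} → row k ≡ row l → col k ≡ col l → k ≡ l) →
      (∀ k τ → k ℕ.< N → Frame (for i n P) σ τ → Untouched k τ →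
        Sets P (setReg i k τ) a (row k) (col k) (v k)) →
      (∀ k → k ℕ.< N → mem (exec (for i n P) σ) a (row k) (col k) ≈ v k) × Untouched N (exec (for i n P) σ)
    for-sets n≡N injective body = for-invariant i n P σ n≡N
      (λ k τ → (∀ l → l ℕ.< k → mem τ a (row l) (col l) ≈ v l) × Untouched k τ)
      ((λ _ ()) , λ _ _ _ → ≡.refl)
      (λ k τ k<n frame (done , untouched) →
        let sets = body k τ k<n frame untouched in
        next k τ done sets ,
        λ x y fresh → ≡.trans
          (miss sets x y (fresh k (ℕₚ.n<1+n k)))
          (untouched x y λ l l<k → fresh l (ℕₚ.m<n⇒m<1+n l<k)))
      where
      next : ∀ k τ → (∀ l → l ℕ.< k → mem τ a (row l) (col l) ≈ v l) →
        Sets P (setReg i k τ) a (row k) (col k) (v k) →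
        ∀ l → l ℕ.< suc k → mem (exec P (setReg i k τ)) a (row l) (col l) ≈ v l
      next k τ done sets l l<1+k with ℕₚ.m≤n⇒m<n∨m≡n (ℕ.s≤s⁻¹ l<1+k)
      ... | inj₂ ≡.refl = hit sets
      ... | inj₁ l<k    = trans
        (reflexive (miss sets (row l) (col l) λ (r≡ , c≡) → ℕₚ.<⇒≢ l<k (injective r≡ c≡)))
        (done l l<k)

  setReg-cong : ∀ i r k {σ τ} → (i ≢ r → reg τ r ≡ reg σ r) → reg (setReg i k τ) r ≡ reg (setReg i k σ) r
  setReg-cong i r k τ≡σ with i ℕₚ.≟ r
  ... | yes _  = ≡.refl
  ... | no i≢r = τ≡σ i≢r

  -- Fragments of the program

  opaque
    unfolding exec

    -- The disequalities keep the accumulator `s` and the scratch array 7 apart from the arrays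
    -- being read. The factors may therefore be described in the initial state, with only the loop
    -- register changed.
    innerProduct-correct : ∀ s a i j b k l n σ {N} →
      {False (7 ℕₚ.≟ s)} → {False (s ℕₚ.≟ a)} → {False (7 ℕₚ.≟ a)} → {False (s ℕₚ.≟ b)} → {False (7 ℕₚ.≟ b)} →
      reg σ n ≡ N → reg σ 4 ≡ 0 → ∀ f g →
      (∀ t → t ℕ.< N → read (setReg 3 t σ) (at a i j) ≈ f t) →
      (∀ t → t ℕ.< N → read (setReg 3 t σ) (at b k l) ≈ g t) →
      mem (exec (innerProduct s (at a i j) (at b k l) n) σ) s 0 0 ≈ dot N f g
    innerProduct-correct s a i j b k l n σ {N} {7≢s} {s≢a} {7≢a} {s≢b} {7≢b} n≡N σ₄≡0 f g left right =
      for-invariant 3 n body σ₁ n≡N (λ t τ → mem τ s 0 0 ≈ dot t f g)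
        (reflexive (write-hit s 4 4 0# σ σ₄≡0 σ₄≡0)) step
      where
      body : Program
      body = assign (scalar 7) (apply mul (at a i j) (at b k l)) ⨾
             assign (scalar s) (apply add (scalar s) (scalar 7))

      σ₁ : State
      σ₁ = run (assign (scalar s) zeroᴱ) σ

      factor : ∀ {t τ} a i j → False (s ℕₚ.≟ a) → False (7 ℕₚ.≟ a) → Frame (for 3 n body) σ₁ τ →
        read (setReg 3 t τ) (at a i j) ≡ read (setReg 3 t σ) (at a i j)
      factor {t} {τ} a i j s≢a 7≢a frame = ≡.trans
        (read-at {setReg 3 t τ} (register i) (register j))
        (≡.trans (mem≡ frame a {7≢a , s≢a} _ _) (write-other 4 4 0# σ (toWitnessFalse s≢a) _ _))
        where
        register : ∀ r → reg (setReg 3 t τ) r ≡ reg (setReg 3 t σ) r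
        register r = setReg-cong 3 r t {σ} {τ} λ 3≢r → reg≡ frame r {fromWitnessFalse 3≢r , _}

      step : ∀ t τ → t ℕ.< N → Frame (for 3 n body) σ₁ τ → mem τ s 0 0 ≈ dot t f g →
        mem (exec body (setReg 3 t τ)) s 0 0 ≈ dot (suc t) f g
      step t τ t<n frame sum≈ = begin
        mem (exec body τ₁) s 0 0
          ≡⟨ write-hit s 4 4 (read τ₂ (scalar s) + read τ₂ (scalar 7)) τ₂ τ₄≡0 τ₄≡0 ⟩
        read τ₂ (scalar s) + read τ₂ (scalar 7)
          ≈⟨ +-cong (reflexive accumulator) (reflexive (write-hit 7 4 4 product τ₁ ≡.refl ≡.refl)) ⟩
        mem τ s 0 0 + product
          ≈⟨ +-cong sum≈ (*-cong
               (trans (reflexive (factor {t} {τ} a i j s≢a 7≢a frame)) (left t t<n))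
               (trans (reflexive (factor {t} {τ} b k l s≢b 7≢b frame)) (right t t<n))) ⟩
        dot t f g + f t * g t
          ≈⟨ sum-snoc t (λ l → f l * g l) ⟨
        dot (suc t) f g ∎
        where
        τ₁ τ₂ : State
        τ₁ = setReg 3 t τ
        τ₂ = run (assign (scalar 7) (apply mul (at a i j) (at b k l))) τ₁

        product : Carrier
        product = read τ₁ (at a i j) * read τ₁ (at b k l)

        τ₄≡0 : reg τ 4 ≡ 0
        τ₄≡0 = ≡.trans (reg≡ frame 4) σ₄≡0

        accumulator : read τ₂ (scalar s) ≡ mem τ s 0 0
        accumulator = ≡.trans (write-other 4 4 product τ₁ (toWitnessFalse 7≢s) _ _)
          (≡.cong₂ (mem τ s) τ₄≡0 τ₄≡0)
  opaque
    unfolding exec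

    updateEntry-sets : ∀ {σ i j l s a b} → reg σ 1 ≡ i → reg σ 2 ≡ j → reg σ 3 ≡ l → reg σ 4 ≡ 0 →
      mem σ 6 0 0 ≡ s → mem σ 5 j l ≡ a → mem σ 5 i l ≡ b → Sets updateEntry σ 5 j l (a - s * b)
    updateEntry-sets {σ} {i} {j} {l} ≡.refl ≡.refl ≡.refl σ₄≡0 ≡.refl ≡.refl ≡.refl =
      sets-⨾ (sets-assign {σ = τ} ≡.refl ≡.refl (+-congˡ (-‿cong (reflexive change))))
      where
      τ : State
      τ = run (assign (scalar 7) (apply mul (scalar 6) (at 5 1 3))) σ

      change : read τ (scalar 7) ≡ mem σ 6 0 0 * mem σ 5 i l
      change = ≡.trans (write-hit 7 4 4 _ σ ≡.refl ≡.refl)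
        (≡.cong (λ s → s * mem σ 5 i l) (≡.cong₂ (mem σ 6) σ₄≡0 σ₄≡0))

    advanceEntry-sets : ∀ {σ i z a b} → reg σ 1 ≡ i → reg σ 4 ≡ 0 →
      mem σ 3 0 0 ≡ z → mem σ 4 i 0 ≡ a → mem σ 2 i 0 ≡ b → Sets advanceEntry σ 4 i 0 (a + z * b)
    advanceEntry-sets {σ} {i} ≡.refl σ₄≡0 ≡.refl ≡.refl ≡.refl =
      sets-⨾ (sets-assign {σ = τ} ≡.refl σ₄≡0
        (+-cong (reflexive (≡.cong (mem σ 4 i) σ₄≡0)) (reflexive change)))
      where
      τ : State
      τ = run (assign (scalar 7) (apply mul (scalar 3) (at 2 1 4))) σ

      change : read τ (scalar 7) ≡ mem σ 3 0 0 * mem σ 2 i 0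
      change = ≡.trans (write-hit 7 4 4 _ σ ≡.refl ≡.refl)
        (≡.cong₂ _*_ (≡.cong₂ (mem σ 3) σ₄≡0 σ₄≡0) (≡.cong (mem σ 2 i) σ₄≡0))

    quotient-result : ∀ {σ i s d a b x} → reg σ 1 ≡ i → reg σ 4 ≡ 0 → mem σ 9 0 0 ≡ 0# →
      mem σ 6 0 0 ≡ s → mem σ 8 0 0 ≡ d → mem σ 1 i 0 ≡ a → mem σ 2 i 0 ≡ b → mem σ 4 i 0 ≡ x →
      mem (exec quotient σ) 6 0 0 ≡ 0# - (x + (a + s)) ÷ (b + (1# + d))
    quotient-result {σ} {i} {s} {d} {a} {b} {x} ≡.refl σ₄≡0 zero≡ s≡ d≡ a≡ b≡ x≡ =
      ≡.trans (write-hit 6 4 4 _ τ₆ σ₄≡0 σ₄≡0) (≡.cong₂ _-_ (≡.trans (scalar≡ 9) zero≡)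
        (≡.trans (write-hit 6 4 4 _ τ₅ ≡.refl ≡.refl) (≡.cong₂ _÷_ numerator denominator)))
      where
      τ₁ τ₂ τ₃ τ₄ τ₅ τ₆ : State
      τ₁ = run (assign (scalar 7) oneᴱ) σ
      τ₂ = run (assign (scalar 8) (apply add (scalar 7) (scalar 8))) τ₁
      τ₃ = run (assign (scalar 8) (apply add (at 2 1 4) (scalar 8))) τ₂
      τ₄ = run (assign (scalar 6) (apply add (at 1 1 4) (scalar 6))) τ₃
      τ₅ = run (assign (scalar 6) (apply add (at 4 1 4) (scalar 6))) τ₄
      τ₆ = run (assign (scalar 6) (apply div (scalar 6) (scalar 8))) τ₅

      scalar≡ : ∀ a → read σ (scalar a) ≡ mem σ a 0 0
      scalar≡ a = ≡.cong₂ (mem σ a) σ₄≡0 σ₄≡0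

      entry≡ : ∀ a → read σ (at a 1 4) ≡ mem σ a i 0
      entry≡ a = ≡.cong (mem σ a i) σ₄≡0

      denominator : read τ₃ (scalar 8) ≡ b + (1# + d)
      denominator = ≡.trans (write-hit 8 4 4 _ τ₂ ≡.refl ≡.refl) (≡.cong₂ _+_ (≡.trans (entry≡ 2) b≡)
        (≡.trans (write-hit 8 4 4 _ τ₁ ≡.refl ≡.refl)
          (≡.cong₂ _+_ (write-hit 7 4 4 1# σ ≡.refl ≡.refl) (≡.trans (scalar≡ 8) d≡))))

      numerator : read τ₅ (scalar 6) ≡ x + (a + s)
      numerator = ≡.trans (write-hit 6 4 4 _ τ₄ ≡.refl ≡.refl) (≡.cong₂ _+_ (≡.trans (entry≡ 4) x≡)
        (≡.trans (write-hit 6 4 4 _ τ₃ ≡.refl ≡.refl)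
          (≡.cong₂ _+_ (≡.trans (entry≡ 1) a≡) (≡.trans (scalar≡ 6) s≡))))

  -- Correctness of the phases

  module Correctness {m} (M : Matrix m m) (q u : Vec m) (solution : SOL e M u)
    (nondegenerate : NondegenerateSolution e M u) where

    open RayEndpoint M q u solution nondegenerate
    open BorderedSystem M q u 0≤u (proj₂ (proj₂ nondegenerate))

    private
      N : ℕ
      N = suc m

    -- Collects what the phases after `setup` read but do not write, so that it passes along by
    -- frames alone.
    record Ready (σ : State) : Set c where
      field
        reg₀ : reg σ 0 ≡ N
        reg₄ : reg σ 4 ≡ 0
        reg₅ : reg σ 5 ≡ m
        mem₀ : ∀ i j → mem σ 0 i j ≡ padMatrix M i j
        mem₁ : ∀ i → mem σ 1 i 0 ≡ pad q i
        mem₂ : ∀ i → mem σ 2 i 0 ≡ pad u i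
        mem₉ : mem σ 9 0 0 ≡ 0#

    open Ready

    ready-frame : ∀ {P σ τ} → Frame P σ τ →
      {KeepsRegister 0 P} → {KeepsRegister 4 P} → {KeepsRegister 5 P} →
      {KeepsArray 0 P} → {KeepsArray 1 P} → {KeepsArray 2 P} → {KeepsArray 9 P} →
      Ready σ → Ready τ
    ready-frame frame {r0} {r4} {r5} {a0} {a1} {a2} {a9} ready = record
      { reg₀ = ≡.trans (reg≡ frame 0 {r0}) (reg₀ ready)
      ; reg₄ = ≡.trans (reg≡ frame 4 {r4}) (reg₄ ready)
      ; reg₅ = ≡.trans (reg≡ frame 5 {r5}) (reg₅ ready)
      ; mem₀ = λ i j → ≡.trans (mem≡ frame 0 {a0} i j) (mem₀ ready i j)
      ; mem₁ = λ i → ≡.trans (mem≡ frame 1 {a1} i 0) (mem₁ ready i)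
      ; mem₂ = λ i → ≡.trans (mem≡ frame 2 {a2} i 0) (mem₂ ready i)
      ; mem₉ = ≡.trans (mem≡ frame 9 {a9} 0 0) (mem₉ ready)
      }

    ready-setReg : ∀ i k {σ} → {False (i ℕₚ.≟ 0)} → {False (i ℕₚ.≟ 4)} → {False (i ℕₚ.≟ 5)} →
      Ready σ → Ready (setReg i k σ)
    ready-setReg i k {σ} {i≢0} {i≢4} {i≢5} ready = record
      { reg₀ = ≡.trans (setReg-other k σ (toWitnessFalse i≢0)) (reg₀ ready)
      ; reg₄ = ≡.trans (setReg-other k σ (toWitnessFalse i≢4)) (reg₄ ready)
      ; reg₅ = ≡.trans (setReg-other k σ (toWitnessFalse i≢5)) (reg₅ ready)
      ; mem₀ = mem₀ ready ; mem₁ = mem₁ ready ; mem₂ = mem₂ ready ; mem₉ = mem₉ ready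
      }

    -- Building the bordered matrix

    buildEntry-sets : ∀ {σ i j} → Ready σ → reg σ 1 ≡ i → reg σ 2 ≡ j →
      Sets buildEntry σ 5 i j (bordered i j)
    buildEntry-sets {σ} {i} {j} ready ≡.refl ≡.refl =
      sets-value value (sets-branch
        (sets-branch {1 ≡ʳ 2} (sets-assign ≡.refl ≡.refl refl) (sets-assign ≡.refl ≡.refl refl))
        (sets-branch {2 ≡ʳ 5}
          (sets-assign ≡.refl ≡.refl (reflexive qᵢ))
          (sets-assign ≡.refl ≡.refl (reflexive (mem₀ ready i j)))))
      where
      qᵢ : read σ (at 1 1 4) ≡ pad q i
      qᵢ = ≡.trans (≡.cong (mem σ 1 i) (reg₄ ready)) (mem₁ ready i)

      value : (if holds σ (at 2 1 4 ≤ᶠ scalar 9) then δ i j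
               else (if holds σ (2 ≡ʳ 5) then pad q i else padMatrix M i j)) ≡ bordered i j
      value
        -- `bordered` branches exactly as the program does; once the operands of the tests are
        -- identified, both sides coincide.
        rewrite ≡.trans (≡.cong (mem σ 2 i) (reg₄ ready)) (mem₂ ready i)
              | ≡.trans (≡.cong₂ (mem σ 9) (reg₄ ready) (reg₄ ready)) (mem₉ ready)
              | reg₅ ready
              = ≡.refl

    build-correct : ∀ {σ} → Ready σ → ∀ i → i ℕ.< N → ∀ j → j ℕ.< N → mem (exec build σ) 5 i j ≈ bordered i j
    build-correct {σ} ready = for-invariant 1 0 buildRow σ (reg₀ ready)
      (λ k τ → ∀ i → i ℕ.< k → ∀ j → j ℕ.< N → mem τ 5 i j ≈ bordered i j)
      (λ _ ()) step
      where
      row-built : ∀ k τ → Frame build σ τ → _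
      row-built k τ frame = for-sets {i = 2} {n = 0} {P = buildEntry} {σ = setReg 1 k τ} {a = 5}
        {row = λ _ → k} {col = λ l → l} {v = bordered k} (reg₀ ready₁) (λ _ l≡l′ → l≡l′)
        λ l τ′ l<N frame′ _ → buildEntry-sets (ready-setReg 2 l (ready-frame frame′ ready₁)) (reg≡ frame′ 1) ≡.refl
        where
        ready₁ : Ready (setReg 1 k τ)
        ready₁ = ready-setReg 1 k (ready-frame frame ready)

      step : ∀ k τ → k ℕ.< N → Frame build σ τ →
        (∀ i → i ℕ.< k → ∀ j → j ℕ.< N → mem τ 5 i j ≈ bordered i j) →
        ∀ i → i ℕ.< suc k → ∀ j → j ℕ.< N → mem (exec buildRow (setReg 1 k τ)) 5 i j ≈ bordered i j
      step k τ k<N frame rows i i<1+k j j<N with ℕₚ.m≤n⇒m<n∨m≡n (ℕ.s≤s⁻¹ i<1+k)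
      ... | inj₂ ≡.refl = proj₁ (row-built k τ frame) j j<N
      ... | inj₁ i<k    = trans
        (reflexive (proj₂ (row-built k τ frame) i j λ _ _ (i≡k , _) → ℕₚ.<⇒≢ i<k i≡k)) (rows i i<k j j<N)

    -- Gram–Schmidt elimination

    reduceRow-correct : ∀ {σ k j} → Ready σ → reg σ 1 ≡ k → reg σ 2 ≡ j → k ℕ.< m → k ℕ.< j →
      Partial m bordered (mem σ 5) k j → Partial m bordered (mem (exec reduceRow σ) 5) k (suc j)
    reduceRow-correct {σ} {k} {j} ready σ-row-k σ-row-j k<m k<j partial =
      ≡.subst (λ τ → Partial m bordered (mem τ 5) k (suc j)) (≡.sym reduceRow≡)
        (reduce-row k<m k<j
          (λ i i≢j l → ≡.trans (proj₂ updated i l λ _ _ (i≡j , _) → i≢j i≡j) (A₃≡A i l))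
          (proj₁ updated) scaled partial)
      where
      A : Rows
      A = mem σ 5

      P₁ P₂ P₃ : Program
      P₁ = innerProduct 8 (at 5 1 3) (at 5 1 3) 0
      P₂ = innerProduct 6 (at 5 2 3) (at 5 1 3) 0
      P₃ = assign (scalar 6) (apply div (scalar 6) (scalar 8))

      σ₁ σ₂ σ₃ : State
      σ₁ = exec P₁ σ
      σ₂ = exec P₂ σ₁
      σ₃ = exec P₃ σ₂

      reduceRow≡ : exec reduceRow σ ≡ exec updateRow σ₃
      reduceRow≡ = ≡.trans (exec-⨾ P₁ _ σ) (≡.trans (exec-⨾ P₂ _ σ₁) (exec-⨾ P₃ _ σ₂))

      frame₁ : Frame P₁ σ σ₁
      frame₁ = exec-frame P₁ σ

      frame₂ : Frame P₂ σ₁ σ₂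
      frame₂ = exec-frame P₂ σ₁

      frame₃ : Frame P₃ σ₂ σ₃
      frame₃ = exec-frame P₃ σ₂

      ready₁ : Ready σ₁
      ready₁ = ready-frame frame₁ ready

      ready₂ : Ready σ₂
      ready₂ = ready-frame frame₂ ready₁

      ready₃ : Ready σ₃
      ready₃ = ready-frame frame₃ ready₂

      A₃≡A : ∀ i l → mem σ₃ 5 i l ≡ A i l
      A₃≡A i l = ≡.trans (mem≡ frame₃ 5 i l) (≡.trans (mem≡ frame₂ 5 i l) (mem≡ frame₁ 5 i l))

      σ₁-row-k : reg σ₁ 1 ≡ k
      σ₁-row-k = ≡.trans (reg≡ frame₁ 1) σ-row-k

      σ₁-row-j : reg σ₁ 2 ≡ j
      σ₁-row-j = ≡.trans (reg≡ frame₁ 2) σ-row-j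

      σ₃-row-k : reg σ₃ 1 ≡ k
      σ₃-row-k = ≡.trans (reg≡ frame₃ 1) (≡.trans (reg≡ frame₂ 1) σ₁-row-k)

      σ₃-row-j : reg σ₃ 2 ≡ j
      σ₃-row-j = ≡.trans (reg≡ frame₃ 2) (≡.trans (reg≡ frame₂ 2) σ₁-row-j)

      norm : mem σ₁ 8 0 0 ≈ dot N (A k) (A k)
      norm = innerProduct-correct 8 5 1 3 5 1 3 0 σ (reg₀ ready) (reg₄ ready) (A k) (A k) row row
        where
        row : ∀ t → t ℕ.< N → mem σ 5 (reg σ 1) t ≈ A k t
        row t _ = reflexive (≡.cong (λ i → A i t) σ-row-k)

      product : mem σ₂ 6 0 0 ≈ dot N (A j) (A k)
      product = innerProduct-correct 6 5 2 3 5 1 3 0 σ₁ (reg₀ ready₁) (reg₄ ready₁) (A j) (A k)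
        (λ t _ → reflexive (≡.trans (≡.cong (λ i → mem σ₁ 5 i t) σ₁-row-j) (mem≡ frame₁ 5 j t)))
        (λ t _ → reflexive (≡.trans (≡.cong (λ i → mem σ₁ 5 i t) σ₁-row-k) (mem≡ frame₁ 5 k t)))

      s : Carrier
      s = mem σ₂ 6 0 0 ÷ mem σ₂ 8 0 0

      norm₂ : mem σ₂ 8 0 0 ≈ dot N (A k) (A k)
      norm₂ = trans (reflexive (mem≡ frame₂ 8 0 0)) norm

      scaled : s * dot N (A k) (A k) ≈ dot N (A j) (A k)
      scaled = begin
        s * dot N (A k) (A k)     ≈⟨ *-congˡ norm₂ ⟨
        s * mem σ₂ 8 0 0
          ≈⟨ ÷-* (mem σ₂ 6 0 0) (λ D≈0 → norm≉0 partial k (ℕₚ.<-trans k<m (ℕₚ.n<1+n m)) (trans (sym norm₂) D≈0)) ⟩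
        mem σ₂ 6 0 0              ≈⟨ product ⟩
        dot N (A j) (A k)         ∎

      factor : mem σ₃ 6 0 0 ≡ s
      factor = ≡.trans
        (exec-assign 6 4 4 (apply div (scalar 6) (scalar 8)) σ₂ (reg₄ ready₂) (reg₄ ready₂))
        (≡.cong₂ _÷_ (≡.cong₂ (mem σ₂ 6) (reg₄ ready₂) (reg₄ ready₂))
          (≡.cong₂ (mem σ₂ 8) (reg₄ ready₂) (reg₄ ready₂)))

      Updated : State → ℕ → Set c
      Updated τ l = ∀ x y → (∀ t → t ℕ.< l → ¬ (x ≡ j × y ≡ t)) → mem τ 5 x y ≡ mem σ₃ 5 x y

      update : ∀ l τ → l ℕ.< N → Frame updateRow σ₃ τ → Updated τ l →
        Sets updateEntry (setReg 3 l τ) 5 j l (A j l - s * A k l)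
      -- Earlier passes wrote only row `j` in columns below `l`. Entry `(j , l)` and the pivot row,
      -- which is another row as `k < j`, still hold their old values.
      update l τ _ frame untouched = updateEntry-sets
        (≡.trans (reg≡ frame 1) σ₃-row-k) (≡.trans (reg≡ frame 2) σ₃-row-j) ≡.refl
        (≡.trans (reg≡ frame 4) (reg₄ ready₃)) (≡.trans (mem≡ frame 6 0 0) factor)
        (≡.trans (untouched j l λ t t<l (_ , l≡t) → ℕₚ.<⇒≢ t<l (≡.sym l≡t)) (A₃≡A j l))
        (≡.trans (untouched k l λ _ _ (k≡j , _) → ℕₚ.<⇒≢ k<j k≡j) (A₃≡A k l))

      updated : (∀ l → l ℕ.< N → mem (exec updateRow σ₃) 5 j l ≈ A j l - s * A k l) ×
        Updated (exec updateRow σ₃) N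
      updated = for-sets {row = λ _ → j} {col = λ l → l} (reg₀ ready₃) (λ _ l≡l′ → l≡l′) update

    considerRow-correct : ∀ {σ k j} → Ready σ → reg σ 1 ≡ k → reg σ 2 ≡ j → k ℕ.< m →
      Partial m bordered (mem σ 5) k j → Partial m bordered (mem (exec considerRow σ) 5) k (suc j)
    considerRow-correct {σ} {k} {j} ready row-k row-j k<m partial =
      branch-rule {t = 2 ≤ʳ 1} {skip} {reduceRow} {σ}
        (j ℕₚ.≤? k) (≡.cong₂ (λ x y → ⌊ x ℕₚ.≤? y ⌋) row-j row-k) Φ
        (λ j≤k → ≡.subst Φ (≡.sym (exec-skip σ)) (skip-row j≤k partial))
        (λ j≰k → reduceRow-correct ready row-k row-j k<m (ℕₚ.≰⇒> j≰k) partial)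
      where
      Φ : State → Set (c ⊔ ℓ₁)
      Φ τ = Partial m bordered (mem τ 5) k (suc j)

    eliminate-correct : ∀ {σ} → Ready σ → Partial m bordered (mem σ 5) 0 0 →
      Partial m bordered (mem (exec eliminate σ) 5) m 0
    eliminate-correct {σ} ready start = for-invariant 1 5 reduceRows σ (reg₅ ready)
      (λ k τ → Partial m bordered (mem τ 5) k 0) start
      λ k τ k<m frame partial → next-row (rows k τ k<m frame partial)
      where
      rows : ∀ k τ → k ℕ.< m → Frame eliminate σ τ → Partial m bordered (mem τ 5) k 0 →
        Partial m bordered (mem (exec reduceRows (setReg 1 k τ)) 5) k N
      rows k τ k<m frame partial = for-invariant 2 0 considerRow (setReg 1 k τ)
        (reg₀ ready₁) (λ j τ′ → Partial m bordered (mem τ′ 5) k j) partial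
        λ j τ′ _ frame′ partial′ →
          considerRow-correct (ready-setReg 2 j (ready-frame frame′ ready₁)) (reg≡ frame′ 1) ≡.refl k<m partial′
        where
        ready₁ : Ready (setReg 1 k τ)
        ready₁ = ready-setReg 1 k (ready-frame frame ready)

    normalise-correct : ∀ {σ} → Ready σ → ∀ i → i ℕ.< m →
      mem (exec normalise σ) 4 i 0 ≈ mem σ 5 m i ÷ mem σ 5 m m
    normalise-correct {σ} ready = proj₁ (for-sets {row = λ l → l} {col = λ _ → 0} (reg₅ ready) (λ l≡l′ _ → l≡l′) body)
      where
      value : ℕ → Carrier
      value i = mem σ 5 m i ÷ mem σ 5 m m

      body : ∀ k τ → k ℕ.< m → Frame normalise σ τ → _ → Sets normaliseEntry (setReg 1 k τ) 4 k 0 (value k)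
      body k τ _ frame _ = sets-assign {t = apply div (at 5 5 1) (at 5 5 5)} {σ = setReg 1 k τ}
        ≡.refl (reg₄ ready₁) (reflexive quotient≡)
        where
        ready₁ : Ready (setReg 1 k τ)
        ready₁ = ready-setReg 1 k (ready-frame frame ready)

        entry : ∀ i → mem τ 5 (reg τ 5) i ≡ mem σ 5 m i
        entry i = ≡.trans (≡.cong (λ r → mem τ 5 r i) (reg₅ ready₁)) (mem≡ frame 5 m i)

        quotient≡ : mem τ 5 (reg τ 5) k ÷ mem τ 5 (reg τ 5) (reg τ 5) ≡ value k
        quotient≡ = ≡.cong₂ _÷_ (entry k) (≡.trans (≡.cong (mem τ 5 (reg τ 5)) (reg₅ ready₁)) (entry m))

    -- The step length

    module _ (x : Vec m) where

      Solved : State → Set ℓ₁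
      Solved σ = ∀ i → mem σ 4 (toℕ i) 0 ≈ x i

      -- The ratio is characterised by the equation it solves: it is the parameter at which row `i`
      -- blocks.
      ratio-correct : ∀ {σ} i → Ready σ → Solved σ → reg σ 1 ≡ toℕ i →
        offset x i + mem (exec ratio σ) 6 0 0 * slope i ≈ 0#
      ratio-correct {σ} i ready solved row = begin
        offset x i + mem (exec ratio σ) 6 0 0 * slope i
          ≈⟨ +-cong (sym S≈offset) (*-cong (reflexive t≡) (sym D≈slope)) ⟩
        S + (0# - S ÷ D) * D
          ≈⟨ solve 3 (λ s r d → s :+ (con (+ 0) :- r) :* d := s :- r :* d) refl S (S ÷ D) D ⟩
        S - (S ÷ D) * D
          ≈⟨ +-congˡ (-‿cong (÷-* S λ D≈0 → slope≉0 i (trans (sym D≈slope) D≈0))) ⟩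
        S - S
          ≈⟨ -‿inverseʳ S ⟩
        0# ∎
        where
        P₁ P₂ : Program
        P₁ = innerProduct 8 (at 0 1 3) (at 2 3 4) 5
        P₂ = innerProduct 6 (at 0 1 3) (at 4 3 4) 5

        σ₁ σ₂ : State
        σ₁ = exec P₁ σ
        σ₂ = exec P₂ σ₁

        frame₁ : Frame P₁ σ σ₁
        frame₁ = exec-frame P₁ σ

        frame₂ : Frame P₂ σ₁ σ₂
        frame₂ = exec-frame P₂ σ₁

        ready₁ : Ready σ₁
        ready₁ = ready-frame frame₁ ready

        ready₂ : Ready σ₂
        ready₂ = ready-frame frame₂ ready₁

        row₁ : reg σ₁ 1 ≡ toℕ i
        row₁ = ≡.trans (reg≡ frame₁ 1) row

        solved₁ : Solved σ₁
        solved₁ j = trans (reflexive (mem≡ frame₁ 4 (toℕ j) 0)) (solved j)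

        Mu : mem σ₁ 8 0 0 ≈ (M ⊛ u) i
        Mu = trans
          (innerProduct-correct 8 0 1 3 2 3 4 5 σ (reg₅ ready) (reg₄ ready) (padMatrix M (toℕ i)) (pad u)
            (λ t _ → reflexive (≡.trans (≡.cong (λ r → mem σ 0 r t) row) (mem₀ ready (toℕ i) t)))
            (λ t _ → reflexive (≡.trans (≡.cong (mem σ 2 t) (reg₄ ready)) (mem₂ ready t))))
          (⟨⟩-cong (λ j → reflexive (padMatrix-toℕ i j)) (λ j → reflexive (pad-toℕ u j)))

        Mx : mem σ₂ 6 0 0 ≈ (M ⊛ x) i
        Mx = trans
          (innerProduct-correct 6 0 1 3 4 3 4 5 σ₁ (reg₅ ready₁) (reg₄ ready₁) (padMatrix M (toℕ i)) (λ t → mem σ₁ 4 t 0)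
            (λ t _ → reflexive (≡.trans (≡.cong (λ r → mem σ₁ 0 r t) row₁) (mem₀ ready₁ (toℕ i) t)))
            (λ t _ → reflexive (≡.cong (mem σ₁ 4 t) (reg₄ ready₁))))
          (⟨⟩-cong (λ j → reflexive (padMatrix-toℕ i j)) solved₁)

        S D : Carrier
        S = mem σ₁ 4 (toℕ i) 0 + (q i + mem σ₂ 6 0 0)
        D = u i + (1# + mem σ₁ 8 0 0)

        S≈offset : S ≈ offset x i
        S≈offset = +-cong (solved₁ i) (+-congˡ Mx)

        D≈slope : D ≈ slope i
        D≈slope = +-congˡ (+-congˡ Mu)

        ratio≡ : exec ratio σ ≡ exec quotient σ₂
        ratio≡ = ≡.trans (exec-⨾ P₁ _ σ) (exec-⨾ P₂ quotient σ₁)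

        t≡ : mem (exec ratio σ) 6 0 0 ≡ 0# - S ÷ D
        t≡ = ≡.trans (≡.cong (λ τ → mem τ 6 0 0) ratio≡)
          (quotient-result (≡.trans (reg≡ frame₂ 1) row₁) (reg₄ ready₂) (mem₉ ready₂)
            ≡.refl (mem≡ frame₂ 8 0 0)
            (≡.trans (mem₁ ready₂ (toℕ i)) (pad-toℕ q i))
            (≡.trans (mem₂ ready₂ (toℕ i)) (pad-toℕ u i))
            (mem≡ frame₂ 4 (toℕ i) 0))

      -- Replaces a definition of the maximum: `blocking` remembers that the parameter is the
      -- initial zero or one of the ratios, which is all that extremality of the endpoint needs.
      record Step (k : ℕ) (z₀ : Carrier) : Set (ℓ₁ ⊔ ℓ₂) where
        field
          nonNeg   : 0# ≤ z₀
          feasible : ∀ i → toℕ i ℕ.< k → 0# ≤ offset x i + z₀ * slope i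
          blocking : z₀ ≈ 0# ⊎ (∃[ i ] offset x i + z₀ * slope i ≈ 0#)

      open Step

      -- Slopes are nonnegative, so raising the parameter never spoils a row already treated and a
      -- single sweep suffices.
      increase : ∀ {i y z} → y ≤ z → 0# ≤ offset x i + y * slope i → 0# ≤ offset x i + z * slope i
      increase {i} {y} {z} y≤z feasibleʸ = ≤-respʳ-≈
        (solve 4 (λ f y z g → (f :+ y :* g) :+ (z :- y) :* g := f :+ z :* g) refl (offset x i) y z (slope i))
        (+-nonNeg feasibleʸ (*-nonNeg (x≤y⇒0≤y-x y≤z) (0≤slope i)))

      extend-feasible : ∀ {k z} i → toℕ i ≡ k → (∀ j → toℕ j ℕ.< k → 0# ≤ offset x j + z * slope j) →
        0# ≤ offset x i + z * slope i → ∀ j → toℕ j ℕ.< suc k → 0# ≤ offset x j + z * slope j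
      extend-feasible i ≡.refl before here j j<1+k with ℕₚ.m≤n⇒m<n∨m≡n (ℕ.s≤s⁻¹ j<1+k)
      ... | inj₁ j<k = before j j<k
      ... | inj₂ j≡i rewrite Fin.toℕ-injective j≡i = here

      keep : ∀ {k z t} i → toℕ i ≡ k → offset x i + t * slope i ≈ 0# → t ≤ z → Step k z → Step (suc k) z
      keep i i≡k t-blocks t≤z step = record
        { nonNeg   = nonNeg step
        ; feasible = extend-feasible i i≡k (feasible step) (increase t≤z (≤-reflexive (sym t-blocks)))
        ; blocking = blocking step
        }

      raise : ∀ {k z t} i → toℕ i ≡ k → offset x i + t * slope i ≈ 0# → z ≤ t → Step k z → Step (suc k) t
      raise i i≡k t-blocks z≤t step = record
        { nonNeg   = ≤-trans (nonNeg step) z≤t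
        ; feasible = extend-feasible i i≡k (λ j j<k → increase z≤t (feasible step j j<k)) (≤-reflexive (sym t-blocks))
        ; blocking = inj₂ (i , t-blocks)
        }

      choose-correct : ∀ {σ k} i → toℕ i ≡ k → reg σ 4 ≡ 0 → offset x i + mem σ 6 0 0 * slope i ≈ 0# →
        Step k (mem σ 3 0 0) → Step (suc k) (mem (exec choose σ) 3 0 0)
      choose-correct {σ} {k} i i≡k σ₄≡0 t-blocks step =
        branch-rule {t = scalar 6 ≤ᶠ scalar 3} {skip} {assign (scalar 3) (copy (scalar 6))} {σ}
          (t ≤? z) test (λ τ → Step (suc k) (mem τ 3 0 0))
          (λ t≤z → ≡.subst (λ τ → Step (suc k) (mem τ 3 0 0)) (≡.sym (exec-skip σ)) (keep i i≡k t-blocks t≤z step))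
          (λ t≰z → ≡.subst (Step (suc k)) (≡.sym raised) (raise i i≡k t-blocks (z≤t t≰z) step))
        where
        t z : Carrier
        t = mem σ 6 0 0
        z = mem σ 3 0 0

        scalar≡ : ∀ a → read σ (scalar a) ≡ mem σ a 0 0
        scalar≡ a = ≡.cong₂ (mem σ a) σ₄≡0 σ₄≡0

        test : holds σ (scalar 6 ≤ᶠ scalar 3) ≡ ⌊ t ≤? z ⌋
        test = ≡.cong₂ (λ x y → ⌊ x ≤? y ⌋) (scalar≡ 6) (scalar≡ 3)

        z≤t : ¬ t ≤ z → z ≤ t
        z≤t t≰z with total z t
        ... | inj₁ z≤t = z≤t
        ... | inj₂ t≤z = contradiction t≤z t≰z

        raised : mem (exec (assign (scalar 3) (copy (scalar 6))) σ) 3 0 0 ≡ t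
        raised = ≡.trans (exec-assign 3 4 4 (copy (scalar 6)) σ σ₄≡0 σ₄≡0) (scalar≡ 6)

      stepLength-correct : ∀ {σ} → Ready σ → Solved σ → mem σ 3 0 0 ≡ 0# →
        Step m (mem (exec stepLength σ) 3 0 0)
      stepLength-correct {σ} ready solved σ₃≡0 = for-invariant 1 5 updateStep σ (reg₅ ready)
        (λ k τ → Step k (mem τ 3 0 0))
        (≡.subst (Step 0) (≡.sym σ₃≡0) (record { nonNeg = ≤-refl ; feasible = λ _ () ; blocking = inj₁ refl }))
        update
        where
        update : ∀ k τ → k ℕ.< m → Frame stepLength σ τ → Step k (mem τ 3 0 0) →
          Step (suc k) (mem (exec updateStep (setReg 1 k τ)) 3 0 0)
        update k τ k<m frame before =
          ≡.subst (λ τ′ → Step (suc k) (mem τ′ 3 0 0)) (≡.sym (exec-⨾ ratio choose τ₁))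
            (choose-correct i (Fin.toℕ-fromℕ< k<m)
              (≡.trans (reg≡ ratio-frame 4) (reg₄ ready₁))
              (ratio-correct i ready₁
                (λ j → trans (reflexive (mem≡ frame 4 (toℕ j) 0)) (solved j)) (≡.sym (Fin.toℕ-fromℕ< k<m)))
              (≡.subst (Step k) (≡.sym (mem≡ ratio-frame 3 0 0)) before))
          where
          i : Fin m
          i = fromℕ< k<m

          τ₁ : State
          τ₁ = setReg 1 k τ

          ready₁ : Ready τ₁
          ready₁ = ready-setReg 1 k (ready-frame frame ready)

          ratio-frame : Frame ratio τ₁ (exec ratio τ₁)
          ratio-frame = exec-frame ratio τ₁

    advance-correct : ∀ {σ} → Ready σ → ∀ i →
      mem (exec advance σ) 4 (toℕ i) 0 ≈ mem σ 4 (toℕ i) 0 + mem σ 3 0 0 * u i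
    advance-correct {σ} ready i = trans
      (proj₁ (for-sets {row = λ l → l} {col = λ _ → 0} (reg₅ ready) (λ l≡l′ _ → l≡l′) body) (toℕ i) (Fin.toℕ<n i))
      (+-congˡ (*-congˡ (reflexive (pad-toℕ u i))))
      where
      body : ∀ k τ → k ℕ.< m → Frame advance σ τ →
        (∀ x y → (∀ l → l ℕ.< k → ¬ (x ≡ l × y ≡ 0)) → mem τ 4 x y ≡ mem σ 4 x y) →
        Sets advanceEntry (setReg 1 k τ) 4 k 0 (mem σ 4 k 0 + mem σ 3 0 0 * pad u k)
      body k τ _ frame untouched = advanceEntry-sets ≡.refl (reg₄ ready₁) (mem≡ frame 3 0 0)
        (untouched k 0 λ l l<k (k≡l , _) → ℕₚ.<⇒≢ l<k (≡.sym k≡l)) (mem₂ ready₁ k)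
        where
        ready₁ : Ready (setReg 1 k τ)
        ready₁ = ready-setReg 1 k (ready-frame frame ready)

    -- Composition of the phases

    σ₁ σ₂ σ₃ σ₄ σ₅ σ₆ : State
    -- The transparent `run` is used here because the fields of `ready₁` hold by evaluation.
    σ₁ = run setup (input M q u)
    σ₂ = exec build σ₁
    σ₃ = exec eliminate σ₂
    σ₄ = exec normalise σ₃
    σ₅ = exec stepLength σ₄
    σ₆ = exec advance σ₅

    ready₁ : Ready σ₁
    ready₁ = record
      { reg₀ = ≡.refl ; reg₄ = ≡.refl ; reg₅ = ≡.refl
      ; mem₀ = λ _ _ → ≡.refl ; mem₁ = λ _ → ≡.refl ; mem₂ = λ _ → ≡.refl ; mem₉ = ≡.refl
      }

    ready₂ : Ready σ₂
    ready₂ = ready-frame (exec-frame build σ₁) ready₁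

    ready₃ : Ready σ₃
    ready₃ = ready-frame (exec-frame eliminate σ₂) ready₂

    ready₄ : Ready σ₄
    ready₄ = ready-frame (exec-frame normalise σ₃) ready₃

    ready₅ : Ready σ₅
    ready₅ = ready-frame (exec-frame stepLength σ₄) ready₄

    program≡ : run program (input M q u) ≡ σ₆
    program≡ = ≡.trans (≡.sym (exec≡run main σ₁))
      (≡.trans (exec-⨾ build _ σ₁) (≡.trans (exec-⨾ eliminate _ σ₂)
        (≡.trans (exec-⨾ normalise _ σ₃) (exec-⨾ stepLength advance σ₄))))

    eliminated : Partial m bordered (mem σ₃ 5) m 0
    eliminated = eliminate-correct {σ₂} ready₂ (no-rows (build-correct {σ₁} ready₁) bordered-onto)

    x : Vec m
    x i = mem σ₄ 4 (toℕ i) 0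

    x≋ : ∀ i → x i ≈ mem σ₃ 5 m (toℕ i) ÷ mem σ₃ 5 m m
    x≋ i = normalise-correct {σ₃} ready₃ (toℕ i) (Fin.toℕ<n i)

    blank : mem σ₄ 3 0 0 ≡ 0#
    blank = ≡.trans (mem≡ (exec-frame normalise σ₃) 3 0 0)
      (≡.trans (mem≡ (exec-frame eliminate σ₂) 3 0 0) (mem≡ (exec-frame build σ₁) 3 0 0))

    z₀ : Carrier
    z₀ = output₀ σ₆

    z : Vec m
    z = output σ₆

    z₀≡ : z₀ ≡ mem σ₅ 3 0 0
    z₀≡ = mem≡ (exec-frame advance σ₅) 3 0 0

    step : Step x m z₀
    step = ≡.subst (Step x m) (≡.sym z₀≡) (stepLength-correct x {σ₄} ready₄ (λ _ → refl) blank)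

    z≋ : z ≋ x ⊕ z₀ · u
    z≋ i = trans (advance-correct {σ₅} ready₅ i)
      (+-cong (reflexive (mem≡ (exec-frame stepLength σ₄) 4 (toℕ i) 0)) (*-congʳ (reflexive (≡.sym z₀≡))))

    private
      h-norm = norm≉0 eliminated m (ℕₚ.n<1+n m)
      Bh≈0 = last-row eliminated

    output-vertex : VertexOfELCP e q M (z₀ ∷ z)
    output-vertex = vertex x (x-off (mem σ₃ 5 m) h-norm Bh≈0 x x≋) (x-on (mem σ₃ 5 m) h-norm Bh≈0 x x≋)
      z₀ (Step.nonNeg step) (λ i → Step.feasible step i (Fin.toℕ<n i)) (Step.blocking step) z z≋

    output-ray : ¬ u ≋ 0ᵛ → SR₁ e q M (z₀ , z , 1# , u)
    output-ray = secondary-ray x (x-off (mem σ₃ 5 m) h-norm Bh≈0 x x≋) (x-on (mem σ₃ 5 m) h-norm Bh≈0 x x≋)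
      z₀ (Step.nonNeg step) (λ i → Step.feasible step i (Fin.toℕ<n i)) (Step.blocking step) z z≋

    program-cost : cost program (input M q u) ≤ⁿ evalPoly polynomial m
    program-cost = ≡.subst (cost program (input M q u) ≤ⁿ_)
      (≡.sym (≡.trans (evalPoly-shift (List.[ 2 ] ⊞ costBound main) m) bound≡))
      -- The two successors pay for the two instructions of `setup`. Registers 0 and 5 then hold
      -- `m + 1` and `m`, both at most `m + 1`.
      (ℕ.s≤s (ℕ.s≤s (cost-bounded {0} {5} main σ₁ _ ℕₚ.≤-refl (ℕₚ.n≤1+n m) _ _)))
      where
      bound≡ : evalPoly (List.[ 2 ] ⊞ costBound main) N ≡ 2 ℕ.+ evalPoly (costBound main) N
      bound≡ = ≡.trans (evalPoly-⊞ List.[ 2 ] (costBound main) N)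
        (≡.cong (λ k → 2 ℕ.+ k ℕ.+ evalPoly (costBound main) N) (ℕₚ.*-zeroʳ N))

  theorem : Σ[ P ∈ Program ] Σ[ p ∈ List ℕ ]
    ((m : ℕ) (M : Matrix m m) (q u : Vec m) →
     NondegenerateELCP e q M →
     ¬ (u ≋ 0ᵛ) →
     SOL e M u →
     NondegenerateSolution e M u →
     let σ  = input M q u
         z₀ = output₀ (run P σ)
         z  = output (run P σ)
     in
     cost P σ ≤ⁿ evalPoly p m ×
     VertexOfELCP e q M (z₀ ∷ z) ×
     (0# < z₀ → SR₁ e q M (z₀ , z , 1# , u)))
  theorem = program , polynomial , λ m M q u _ u≉0 solution nondegenerate →
    let open Correctness M q u solution nondegenerate in
    program-cost ,
    ≡.subst (λ τ → VertexOfELCP e q M (output₀ τ ∷ output τ)) (≡.sym program≡) output-vertex ,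
    λ _ → ≡.subst (λ τ → SR₁ e q M (output₀ τ , output τ , 1# , u)) (≡.sym program≡) (output-ray u≉0)

mainTheorem7 : ∀ {c ℓ₁ ℓ₂} (R : OrderedField c ℓ₁ ℓ₂) →
    let open OrderedField R
        open LCP R
        open Machine R
    in
    Σ[ P ∈ Program ] Σ[ p ∈ List ℕ ]
      ((m : ℕ) (M : Matrix m m) (q u : Vec m) →
       NondegenerateELCP e q M →
       ¬ (u ≋ 0ᵛ) →
       SOL e M u →
       NondegenerateSolution e M u →
       let σ  = input M q u
           z₀ = output₀ (run P σ)
           z  = output (run P σ)
       in
       cost P σ ≤ⁿ evalPoly p m ×
       VertexOfELCP e q M (z₀ ∷ z) ×
       (0# < z₀ → SR₁ e q M (z₀ , z , 1# , u)))
mainTheorem7 R = Development.theorem R
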